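{- Let $p$ be a prime, let $\alpha,l,n\in\{0,1,2,\ldots\}$ and $r\in\mathbb{Z}$. Let $r_*$ be the least nonnegative residue of $r$ modulo $p^\alpha$, let $n_*=r_*+\{n-r\}_{p^\alpha}$ where $\{n-r\}_{p^\alpha}$ is the least nonnegative residue of $n-r$ modulo $p^\alpha$, and set $$m=\frac{n-n_*}{p^\alpha}=\left\lfloor\frac{r}{p^\alpha}\right\rfloor+\left\lfloor\frac{n-r}{p^\alpha}\right\rfloor.$$ Suppose that $l\geqslant m>0$ and $$l\equiv m\pmod{(p-1)p^{\lfloor\log_p m\rfloor-\delta_p(\lfloor r/p^\alpha\rfloor,\,m)}},$$ where for $a\in\mathbb{Z}$, $\delta_p(a,m)=1$ if $p\mid a$ and $\log_p m$ is a positive integer, and $\delta_p(a,m)=0$ otherwise. Then $$\frac{1}{\lfloor n/p^\alpha\rfloor!\binom{n_*}{r_*}}\sum_{k\equiv r\ (\mathrm{mod}\ p^\alpha)}(-1)^k\binom{n}{k}\left(\frac{k-r}{p^\alpha}\right)^l\equiv(-1)^{l+r_*}\pmod p.$$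
   Context: The sum runs over all integers $k\equiv r\pmod{p^\alpha}$, with $\binom nk=0$ unless $0\le k\le n$; the convention $0^0=1$ is used. The left-hand side is a rational number, and the congruence modulo $p$ means that its difference with $(-1)^{l+r_*}$ is a rational number lying in $p\mathbb{Z}_p$ (i.e. the left side is a $p$-adic integer congruent to $(-1)^{l+r_*}$ modulo $p$). -}

module Defs where

open import Data.Nat as ℕ using (ℕ; zero; suc; _≤?_; _≟_; _!)
open import Data.Nat.Divisibility using (_∣?_)
open import Data.Nat.Combinatorics using (_C_)
open import Data.Integer as ℤ using (ℤ; +_; -_; _/ℕ_; _%ℕ_; ∣_∣)
open import Data.Integer.Divisibility as ℤD using ()
open import Data.Rational as ℚ using (ℚ)
open import Data.Bool using (Bool; if_then_else_; _∧_)
open import Data.List using (List; foldr; map; upTo)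
open import Data.Product using (∃-syntax; _×_)
open import Relation.Nullary using (¬_; does)
open import Relation.Binary.PropositionalEquality using (_≡_)

-- Floor division / least nonnegative residue by a modulus d.
-- Only ever used with d = p ^ α ≥ 1 (p prime); the value at d = 0 is a
-- dummy (0) so that the functions are total.

_div⁺_ : ℤ → ℕ → ℤ
x div⁺ zero    = + 0
x div⁺ (suc d) = x /ℕ suc d

_mod⁺_ : ℤ → ℕ → ℕ
x mod⁺ zero    = 0
x mod⁺ (suc d) = x %ℕ suc d

_ndiv⁺_ : ℕ → ℕ → ℕ
x ndiv⁺ zero    = 0
x ndiv⁺ (suc d) = x ℕ./ suc d

-- Rational x / d (d is nonzero wherever this is used; dummy 0 at d = 0)
_÷⁺_ : ℤ → ℕ → ℚ
x ÷⁺ zero    = ℚ.0ℚ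
x ÷⁺ (suc d) = x ℚ./ suc d

rStar : (p α : ℕ) → ℤ → ℕ
rStar p α r = r mod⁺ (p ℕ.^ α)

nStar : (p α n : ℕ) → ℤ → ℕ
nStar p α n r = rStar p α r ℕ.+ ((+ n ℤ.- r) mod⁺ (p ℕ.^ α))

mVal : (p α n : ℕ) → ℤ → ℤ
mVal p α n r = (r div⁺ (p ℕ.^ α)) ℤ.+ ((+ n ℤ.- r) div⁺ (p ℕ.^ α))

-- δ_p(a, m), given e = ⌊ log_p m ⌋ :
-- 1 if p ∣ a and log_p m is a positive integer (i.e. m = p^e with e ≥ 1),
-- 0 otherwise.
δ : (p : ℕ) → ℤ → (m e : ℕ) → ℕ
δ p a m e =
  if does (p ∣? ∣ a ∣) ∧ does (1 ≤? e) ∧ does (p ℕ.^ e ≟ m) then 1 else 0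

-- ∑_{0 ≤ k ≤ n, k ≡ r (mod p^α)} (-1)^k C(n,k) ((k - r)/p^α)^l
-- (binomial coefficients vanish outside 0 ≤ k ≤ n; 0^0 = 1 since x ^ 0 = 1)
term : (p α n : ℕ) → ℤ → (l k : ℕ) → ℤ
term p α n r l k =
  if does ((+ k) mod⁺ (p ℕ.^ α) ≟ r mod⁺ (p ℕ.^ α))
  then (ℤ.-1ℤ ℤ.^ k) ℤ.* (+ (n C k)) ℤ.* (((+ k ℤ.- r) div⁺ (p ℕ.^ α)) ℤ.^ l)
  else + 0

binSum : (p α n : ℕ) → ℤ → ℕ → ℤ
binSum p α n r l = foldr ℤ._+_ (+ 0) (map (term p α n r l) (upTo (suc n)))

lhs : (p α n : ℕ) → ℤ → ℕ → ℚ
lhs p α n r l =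
  binSum p α n r l ÷⁺ (((n ndiv⁺ (p ℕ.^ α)) !) ℕ.* (nStar p α n r C rStar p α r))

-- x ≡ y (mod p) in ℤ_p, for rationals x y : x - y ∈ pℤ_p, i.e.
-- x - y = p a / b with a, b integers and p ∤ b.
_≡_[modpℤₚ_] : ℚ → ℚ → ℕ → Set
x ≡ y [modpℤₚ p ] =
  ∃[ a ] ∃[ b ] (¬ (+ p ℤD.∣ b)) × ((x ℚ.- y) ℚ.* (b ℚ./ 1) ≡ (+ p ℤ.* a) ℚ./ 1)

{-# OPTIONS --safe #-}
module Submission where

open import Defs
open import Data.Nat using (ℕ; suc; _+_; _*_; _∸_; _^_; _≤_; _<_)
open import Data.Nat using (zero; z≤n; s≤s; _!)
open import Data.Nat.Divisibility using (_∣_; _∣?_)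
open import Data.Nat.Primality using (Prime; euclidsLemma; prime⇒nonZero; prime⇒nonTrivial; prime⇒irreducible)
open import Data.Nat.Combinatorics using (_C_; nCk+nC[k+1]≡[n+1]C[k+1]; nC1≡n; nCn≡1; k>n⇒nCk≡0)
import Data.Nat as ℕ
import Data.Nat.Properties as ℕₚ
import Data.Nat.Divisibility as ℕ∣
import Data.Nat.DivMod as ℕ/
open import Data.Integer as ℤ using (ℤ; +_; 0ℤ; 1ℤ; -1ℤ)
import Data.Integer.Properties as ℤₚ
import Data.Integer.DivMod as ℤ/
open import Data.Integer.Divisibility.Signed as ℤ∣ using (divides) renaming (_∣_ to _∣ℤ_)
open import Data.Integer.Tactic.RingSolver using (solve-∀)
open import Data.Rational as ℚ using (ℚ)
import Data.Rational.Properties as ℚₚ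
open import Data.Rational.Unnormalised as ℚᵘ using (mkℚᵘ; *≡*)
import Data.Rational.Unnormalised.Properties as ℚᵘₚ
open import Data.Bool using (if_then_else_; _∧_)
open import Data.List using (foldr; map; applyUpTo; upTo)
open import Data.List.Properties using (map-upTo)
open import Data.Product using (∃; _×_; _,_)
open import Data.Sum using (_⊎_; inj₁; inj₂; [_,_]′) renaming (map to map-⊎)
open import Function using (_∘_; _$_)
open import Relation.Nullary using (¬_; Dec; yes; no; does; contradiction)
open import Relation.Nullary.Decidable using (dec-true; dec-false)
open import Relation.Binary.Definitions using (tri<; tri≈; tri>)
open import Relation.Binary.PropositionalEquality
open ≡-Reasoning

-- Write q = p^α, r = r_* + a q, and n = r_* + s + m q with 0 ≤ r_*, s < q, so that n_* = r_* + s
-- and the sum runs over k = r_* + i q, 0 ≤ i ≤ m, with (k - r)/q = i - a.  Expanding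
-- (i - a)^l = ∑_j h(l,j) (i)_j in falling factorials turns it into (-1)^{r_*} ∑_j h(l,j) T_j.
--
-- Here T_j = 0 for j > m, and T_m = ± V with V = m! C(n, r_* + m q), which is the denominator
-- ⌊n/q⌋! C(n_*, r_*) up to a factor in 1 + p ℤ₍ₚ₎.  For j < m one has T_j ∈ p V ℤ₍ₚ₎:
-- absorption identities for binomials give r_* T_j = n T_j′ + q (⋯), with T′ taken at n-1 and
-- r_*-1 (similarly in s), so by induction one may assume r_* = s = 0.  There T_{j+1} reduces to
-- m-1, while T_0 is the value at 0 of ∇^{mq} (∇ = 1 - E, E the shift) on the indicator of q ℤ;
-- it is divisible by p^m, since ∇^q ≡ 1 - E^q mod p, and v_p(m!) < m.
--
-- It remains to see that h(l,m) ≡ 1 mod p.  As x^p - x is the product of p consecutive factors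
-- mod p, h(l+p,m) ≡ h(l+1,m) + h(l,m-p), i.e. (E^p - E) h(·,m) ≡ h(·,m-p).  Raising this to the
-- power p^e makes h(·,m) periodic of period (p-1) p^e; if m = p^e and p ∣ a, the power p^{e-1}
-- already leads to h(l,0) = (-a)^l ≡ 0.

+-congˡ : ∀ a {x y} → x ≡ y → a ℤ.+ x ≡ a ℤ.+ y
+-congˡ a = cong (λ x → a ℤ.+ x)

*-congˡ : ∀ a {x y} → x ≡ y → a ℤ.* x ≡ a ℤ.* y
*-congˡ a = cong (λ x → a ℤ.* x)

-- Finite sums

∑ : ℕ → (ℕ → ℤ) → ℤ
∑ zero    f = 0ℤ
∑ (suc n) f = f 0 ℤ.+ ∑ n (f ∘ suc)

∑-cong : ∀ n {f g : ℕ → ℤ} → (∀ i → f i ≡ g i) → ∑ n f ≡ ∑ n g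
∑-cong zero    eq = refl
∑-cong (suc n) eq = cong₂ ℤ._+_ (eq 0) (∑-cong n (eq ∘ suc))

∑-distrib-+ : ∀ n (f g : ℕ → ℤ) → ∑ n (λ i → f i ℤ.+ g i) ≡ ∑ n f ℤ.+ ∑ n g
∑-distrib-+ zero    f g = refl
∑-distrib-+ (suc n) f g = begin
  (f 0 ℤ.+ g 0) ℤ.+ ∑ n (λ i → f (suc i) ℤ.+ g (suc i))
    ≡⟨ +-congˡ (f 0 ℤ.+ g 0) (∑-distrib-+ n (f ∘ suc) (g ∘ suc)) ⟩
  (f 0 ℤ.+ g 0) ℤ.+ (∑ n (f ∘ suc) ℤ.+ ∑ n (g ∘ suc))
    ≡⟨ interchange (f 0) (g 0) _ _ ⟩
  (f 0 ℤ.+ ∑ n (f ∘ suc)) ℤ.+ (g 0 ℤ.+ ∑ n (g ∘ suc)) ∎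
  where
  interchange : ∀ a b c d → (a ℤ.+ b) ℤ.+ (c ℤ.+ d) ≡ (a ℤ.+ c) ℤ.+ (b ℤ.+ d)
  interchange = solve-∀

∑-distribˡ-* : ∀ n c (f : ℕ → ℤ) → ∑ n (λ i → c ℤ.* f i) ≡ c ℤ.* ∑ n f
∑-distribˡ-* zero    c f = sym (ℤₚ.*-zeroʳ c)
∑-distribˡ-* (suc n) c f = begin
  c ℤ.* f 0 ℤ.+ ∑ n (λ i → c ℤ.* f (suc i)) ≡⟨ +-congˡ (c ℤ.* f 0) (∑-distribˡ-* n c (f ∘ suc)) ⟩
  c ℤ.* f 0 ℤ.+ c ℤ.* ∑ n (f ∘ suc)         ≡⟨ ℤₚ.*-distribˡ-+ c (f 0) _ ⟨
  c ℤ.* (f 0 ℤ.+ ∑ n (f ∘ suc))             ∎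

∑-zero : ∀ n {f : ℕ → ℤ} → (∀ i → i < n → f i ≡ 0ℤ) → ∑ n f ≡ 0ℤ
∑-zero zero    z = refl
∑-zero (suc n) z = cong₂ ℤ._+_ (z 0 (s≤s z≤n)) (∑-zero n λ i i<n → z (suc i) (s≤s i<n))

∑-swap : ∀ n m (f : ℕ → ℕ → ℤ) → ∑ n (λ i → ∑ m (f i)) ≡ ∑ m (λ j → ∑ n (λ i → f i j))
∑-swap zero    m f = sym (∑-zero m λ _ _ → refl)
∑-swap (suc n) m f = begin
  ∑ m (f 0) ℤ.+ ∑ n (λ i → ∑ m (f (suc i)))           ≡⟨ +-congˡ (∑ m (f 0)) (∑-swap n m (f ∘ suc)) ⟩
  ∑ m (f 0) ℤ.+ ∑ m (λ j → ∑ n (λ i → f (suc i) j))   ≡⟨ ∑-distrib-+ m (f 0) _ ⟨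
  ∑ m (λ j → f 0 j ℤ.+ ∑ n (λ i → f (suc i) j))       ∎

∑-split : ∀ m n (f : ℕ → ℤ) → ∑ (m + n) f ≡ ∑ m f ℤ.+ ∑ n (λ i → f (m + i))
∑-split zero    n f = sym (ℤₚ.+-identityˡ _)
∑-split (suc m) n f = begin
  f 0 ℤ.+ ∑ (m + n) (f ∘ suc)                               ≡⟨ +-congˡ (f 0) (∑-split m n (f ∘ suc)) ⟩
  f 0 ℤ.+ (∑ m (f ∘ suc) ℤ.+ ∑ n (λ i → f (suc (m + i))))   ≡⟨ ℤₚ.+-assoc (f 0) _ _ ⟨
  f 0 ℤ.+ ∑ m (f ∘ suc) ℤ.+ ∑ n (λ i → f (suc (m + i)))     ∎

module _ (P : ℤ → Set) (P-0 : P 0ℤ) (P-+ : ∀ {x y} → P x → P y → P (x ℤ.+ y)) where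

  ∑-closed : ∀ n (f : ℕ → ℤ) → (∀ i → i < n → P (f i)) → P (∑ n f)
  ∑-closed zero    f Pf = P-0
  ∑-closed (suc n) f Pf =
    P-+ (Pf 0 (s≤s z≤n)) (∑-closed n (f ∘ suc) λ i i<n → Pf (suc i) (s≤s i<n))

  -- Singles out one summand modulo an additively closed predicate. It serves for being zero, for
  -- divisibility by `p` and for membership in `A ℤ₍ₚ₎`.
  ∑-closed-except : ∀ n k (f : ℕ → ℤ) → k < n → (∀ i → i < n → i ≢ k → P (f i)) → P (∑ n f ℤ.- f k)
  ∑-closed-except (suc n) zero f _ Pf =
    subst P (x≡a+x-a (f 0) _) (∑-closed n (f ∘ suc) λ i i<n → Pf (suc i) (s≤s i<n) λ ())
    where
    x≡a+x-a : ∀ a x → x ≡ a ℤ.+ x ℤ.- a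
    x≡a+x-a = solve-∀
  ∑-closed-except (suc n) (suc k) f (s≤s k<n) Pf =
    subst P (sym (ℤₚ.+-assoc (f 0) _ _))
      (P-+ (Pf 0 (s≤s z≤n) λ ())
           (∑-closed-except n k (f ∘ suc) k<n
             λ i i<n i≢k → Pf (suc i) (s≤s i<n) (i≢k ∘ ℕₚ.suc-injective)))

∑-single : ∀ n k (f : ℕ → ℤ) → k < n → (∀ i → i < n → i ≢ k → f i ≡ 0ℤ) → ∑ n f ≡ f k
∑-single n k f k<n z = ℤₚ.i-j≡0⇒i≡j _ _
  (∑-closed-except (_≡ 0ℤ) refl (cong₂ ℤ._+_) n k f k<n z)

-- Binomial coefficients and iterated differences

-- Kept abstract: the conversion checker would otherwise unfold _C_ to a quotient of factorials.
abstract
  bin : ℕ → ℕ → ℤ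
  bin n k = + (n C k)

  bin≡C : ∀ n k → bin n k ≡ + (n C k)
  bin≡C n k = refl

  bin-pascal : ∀ n k → bin (suc n) (suc k) ≡ bin n k ℤ.+ bin n (suc k)
  bin-pascal n k = trans (cong +_ (sym (nCk+nC[k+1]≡[n+1]C[k+1] n k))) (ℤₚ.pos-+ (n C k) (n C suc k))

  bin-n-0 : ∀ n → bin n 0 ≡ 1ℤ
  bin-n-0 n = refl

  bin-n-1 : ∀ n → bin n 1 ≡ + n
  bin-n-1 n = cong +_ (nC1≡n n)

  bin-n-n : ∀ n → bin n n ≡ 1ℤ
  bin-n-n n = cong +_ (nCn≡1 n)

  bin>≡0 : ∀ {n k} → n < k → bin n k ≡ 0ℤ
  bin>≡0 n<k = cong +_ (k>n⇒nCk≡0 n<k)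

bin-absorb : ∀ n k → + suc k ℤ.* bin (suc n) (suc k) ≡ + suc n ℤ.* bin n k
bin-absorb zero    zero    = *-congˡ 1ℤ (trans (bin-n-n 1) (sym (bin-n-n 0)))
bin-absorb zero    (suc k) = trans (trans (*-congˡ (+ suc (suc k)) (bin>≡0 (s≤s (s≤s z≤n)))) (ℤₚ.*-zeroʳ (+ suc (suc k))))
  (sym (trans (*-congˡ 1ℤ (bin>≡0 {0} {suc k} (s≤s z≤n))) (ℤₚ.*-zeroʳ 1ℤ)))
bin-absorb (suc n) zero    = trans (ℤₚ.*-identityˡ _)
  (trans (bin-n-1 (suc (suc n))) (sym (trans (*-congˡ (+ suc (suc n)) (bin-n-0 (suc n))) (ℤₚ.*-identityʳ _))))
bin-absorb (suc n) (suc k) = begin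
  (1ℤ ℤ.+ + suc k) ℤ.* bin (suc (suc n)) (suc (suc k))
    ≡⟨ *-congˡ (1ℤ ℤ.+ + suc k) (bin-pascal (suc n) (suc k)) ⟩
  (1ℤ ℤ.+ + suc k) ℤ.* (B ℤ.+ bin (suc n) (suc (suc k)))
    ≡⟨ expand (+ suc k) B _ ⟩
  B ℤ.+ (+ suc k ℤ.* B ℤ.+ (1ℤ ℤ.+ + suc k) ℤ.* bin (suc n) (suc (suc k)))
    ≡⟨ +-congˡ B (cong₂ ℤ._+_ (bin-absorb n k) (bin-absorb n (suc k))) ⟩
  B ℤ.+ (+ suc n ℤ.* bin n k ℤ.+ + suc n ℤ.* bin n (suc k))
    ≡⟨ +-congˡ B (ℤₚ.*-distribˡ-+ (+ suc n) (bin n k) (bin n (suc k))) ⟨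
  B ℤ.+ + suc n ℤ.* (bin n k ℤ.+ bin n (suc k))
    ≡⟨ cong (λ z → B ℤ.+ + suc n ℤ.* z) (bin-pascal n k) ⟨
  B ℤ.+ + suc n ℤ.* B
    ≡⟨ collect (+ suc n) B ⟩
  (1ℤ ℤ.+ + suc n) ℤ.* B ∎
  where
  B = bin (suc n) (suc k)
  expand : ∀ k x y → (1ℤ ℤ.+ k) ℤ.* (x ℤ.+ y) ≡ x ℤ.+ (k ℤ.* x ℤ.+ (1ℤ ℤ.+ k) ℤ.* y)
  expand = solve-∀
  collect : ∀ n x → x ℤ.+ n ℤ.* x ≡ (1ℤ ℤ.+ n) ℤ.* x
  collect = solve-∀

-- The factor is an integer difference, so that for `k = r + i * q` it is linear in `i`, the shape
-- that `T-rec` asks for.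
bin-absorb′ : ∀ n k → (+ suc n ℤ.- + k) ℤ.* bin (suc n) k ≡ + suc n ℤ.* bin n k
bin-absorb′ n zero    = cong₂ ℤ._*_ (ℤₚ.+-identityʳ (+ suc n)) (trans (bin-n-0 (suc n)) (sym (bin-n-0 n)))
bin-absorb′ n (suc k) = begin
  (+ suc n ℤ.- + suc k) ℤ.* B                       ≡⟨ distrib (+ suc n) (+ suc k) B ⟩
  + suc n ℤ.* B ℤ.- + suc k ℤ.* B                   ≡⟨ cong₂ (λ x y → + suc n ℤ.* x ℤ.- y) (bin-pascal n k) (bin-absorb n k) ⟩
  + suc n ℤ.* (bin n k ℤ.+ bin n (suc k)) ℤ.- + suc n ℤ.* bin n k ≡⟨ cancel (+ suc n) (bin n k) _ ⟩
  + suc n ℤ.* bin n (suc k)                         ∎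
  where
  B = bin (suc n) (suc k)
  distrib : ∀ a b x → (a ℤ.- b) ℤ.* x ≡ a ℤ.* x ℤ.- b ℤ.* x
  distrib = solve-∀
  cancel : ∀ a x y → a ℤ.* (x ℤ.+ y) ℤ.- a ℤ.* x ≡ a ℤ.* y
  cancel = solve-∀

sgn : ℕ → ℤ
sgn k = -1ℤ ℤ.^ k

-- The operator (1 - E^b)^n, with E the shift by one. The sign is opposite to that of the forward
-- difference, so the expansion carries (-1)^k. The width is 1 for the binomial sums and p - 1 for
-- periodicity.
∇ : ℕ → ℕ → (ℕ → ℤ) → ℕ → ℤ
∇ b zero    φ x = φ x
∇ b (suc n) φ x = ∇ b n φ x ℤ.- ∇ b n φ (x + b)

∇-+ : ∀ b m n φ x → ∇ b (m + n) φ x ≡ ∇ b m (∇ b n φ) x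
∇-+ b zero    n φ x = refl
∇-+ b (suc m) n φ x = cong₂ ℤ._-_ (∇-+ b m n φ x) (∇-+ b m n φ (x + b))

∇-cong : ∀ b n {φ ψ : ℕ → ℤ} → (∀ x → φ x ≡ ψ x) → ∀ x → ∇ b n φ x ≡ ∇ b n ψ x
∇-cong b zero    eq x = eq x
∇-cong b (suc n) eq x = cong₂ ℤ._-_ (∇-cong b n eq x) (∇-cong b n eq (x + b))

∇-scale : ∀ b n c φ x → ∇ b n (λ y → c ℤ.* φ y) x ≡ c ℤ.* ∇ b n φ x
∇-scale b zero    c φ x = refl
∇-scale b (suc n) c φ x = trans (cong₂ ℤ._-_ (∇-scale b n c φ x) (∇-scale b n c φ (x + b)))
  (distrib c (∇ b n φ x) (∇ b n φ (x + b)))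
  where
  distrib : ∀ c x y → c ℤ.* x ℤ.- c ℤ.* y ≡ c ℤ.* (x ℤ.- y)
  distrib = solve-∀

∇-shift : ∀ b n c φ x → ∇ b n (λ y → φ (y + c)) x ≡ ∇ b n φ (x + c)
∇-shift b zero    c φ x = refl
∇-shift b (suc n) c φ x = cong₂ ℤ._-_ (∇-shift b n c φ x)
  (trans (∇-shift b n c φ (x + b)) (cong (∇ b n φ) (swap x b c)))
  where
  swap : ∀ x b c → x + b + c ≡ x + c + b
  swap x b c = trans (ℕₚ.+-assoc x b c) (trans (cong (λ z → x + z) (ℕₚ.+-comm b c)) (sym (ℕₚ.+-assoc x c b)))

-- One difference already kills constants. `frobenius` uses this to remove the last term of the
-- binomial expansion.
∇-subtract-const : ∀ b n c φ x → ∇ b (suc n) (λ y → φ y ℤ.- c) x ≡ ∇ b (suc n) φ x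
∇-subtract-const b zero    c φ x = cancel (φ x) (φ (x + b)) c
  where
  cancel : ∀ x y c → (x ℤ.- c) ℤ.- (y ℤ.- c) ≡ x ℤ.- y
  cancel = solve-∀
∇-subtract-const b (suc n) c φ x =
  cong₂ ℤ._-_ (∇-subtract-const b n c φ x) (∇-subtract-const b n c φ (x + b))

-- The bound `N` may be any number above `n`, since the extra binomials vanish; the induction uses
-- different bounds for the two parts of a difference.
∇-expand : ∀ b n φ x N → n < N →
  ∇ b n φ x ≡ ∑ N (λ k → sgn k ℤ.* bin n k ℤ.* φ (x + k * b))
∇-expand b zero φ x (suc N) _ = sym (begin
  1ℤ ℤ.* bin 0 0 ℤ.* φ (x + 0) ℤ.+ ∑ N (λ k → sgn (suc k) ℤ.* bin 0 (suc k) ℤ.* φ (x + suc k * b))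
    ≡⟨ cong₂ ℤ._+_
         (trans (trans (cong (λ z → 1ℤ ℤ.* z ℤ.* φ (x + 0)) (bin-n-0 0)) (ℤₚ.*-identityˡ (φ (x + 0))))
                (cong φ (ℕₚ.+-identityʳ x)))
         (∑-zero N λ k _ → trans
           (cong (λ z → sgn (suc k) ℤ.* z ℤ.* φ (x + suc k * b)) (bin>≡0 {0} {suc k} (s≤s z≤n)))
           (zeros (sgn (suc k)) (φ (x + suc k * b)))) ⟩
  φ x ℤ.+ 0ℤ ≡⟨ ℤₚ.+-identityʳ _ ⟩
  φ x ∎)
  where
  zeros : ∀ s y → s ℤ.* 0ℤ ℤ.* y ≡ 0ℤ
  zeros = solve-∀
∇-expand b (suc n) φ x (suc N) (s≤s n<N) = begin
  ∇ b n φ x ℤ.- ∇ b n φ (x + b)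
    ≡⟨ cong₂ ℤ._-_ (∇-expand b n φ x (suc N) (ℕₚ.m<n⇒m<1+n n<N)) (∇-expand b n φ (x + b) N n<N) ⟩
  (t n 0 ℤ.+ ∑ N (t n ∘ suc)) ℤ.- ∑ N u
    ≡⟨ rearrange (t n 0) (∑ N (t n ∘ suc)) (∑ N u) ⟩
  t n 0 ℤ.+ (∑ N (t n ∘ suc) ℤ.+ -1ℤ ℤ.* ∑ N u)
    ≡⟨ cong (λ z → t n 0 ℤ.+ (∑ N (t n ∘ suc) ℤ.+ z)) (∑-distribˡ-* N -1ℤ u) ⟨
  t n 0 ℤ.+ (∑ N (t n ∘ suc) ℤ.+ ∑ N (λ k → -1ℤ ℤ.* u k))
    ≡⟨ +-congˡ (t n 0) (∑-distrib-+ N (t n ∘ suc) _) ⟨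
  t n 0 ℤ.+ ∑ N (λ k → t n (suc k) ℤ.+ -1ℤ ℤ.* u k)
    ≡⟨ +-congˡ (t n 0) (∑-cong N merge) ⟩
  t n 0 ℤ.+ ∑ N (t (suc n) ∘ suc)
    ≡⟨ cong (λ z → 1ℤ ℤ.* z ℤ.* φ (x + 0) ℤ.+ ∑ N (t (suc n) ∘ suc)) (trans (bin-n-0 n) (sym (bin-n-0 (suc n)))) ⟩
  t (suc n) 0 ℤ.+ ∑ N (t (suc n) ∘ suc) ∎
  where
  t : ℕ → ℕ → ℤ
  t n k = sgn k ℤ.* bin n k ℤ.* φ (x + k * b)
  u : ℕ → ℤ
  u k = sgn k ℤ.* bin n k ℤ.* φ (x + b + k * b)
  rearrange : ∀ a s v → (a ℤ.+ s) ℤ.- v ≡ a ℤ.+ (s ℤ.+ -1ℤ ℤ.* v)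
  rearrange = solve-∀
  collect : ∀ s x y z → -1ℤ ℤ.* s ℤ.* y ℤ.* z ℤ.+ -1ℤ ℤ.* (s ℤ.* x ℤ.* z) ≡ -1ℤ ℤ.* s ℤ.* (x ℤ.+ y) ℤ.* z
  collect = solve-∀
  merge : ∀ k → t n (suc k) ℤ.+ -1ℤ ℤ.* u k ≡ t (suc n) (suc k)
  merge k = begin
    t n (suc k) ℤ.+ -1ℤ ℤ.* u k
      ≡⟨ cong (λ z → t n (suc k) ℤ.+ -1ℤ ℤ.* (sgn k ℤ.* bin n k ℤ.* φ z)) (ℕₚ.+-assoc x b (k * b)) ⟩
    t n (suc k) ℤ.+ -1ℤ ℤ.* (sgn k ℤ.* bin n k ℤ.* φ (x + suc k * b))
      ≡⟨ collect (sgn k) (bin n k) (bin n (suc k)) (φ (x + suc k * b)) ⟩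
    sgn (suc k) ℤ.* (bin n k ℤ.+ bin n (suc k)) ℤ.* φ (x + suc k * b)
      ≡⟨ cong (λ z → sgn (suc k) ℤ.* z ℤ.* φ (x + suc k * b)) (bin-pascal n k) ⟨
    t (suc n) (suc k) ∎

x∙yz≡y∙xz : ∀ x y z → x ℤ.* (y ℤ.* z) ≡ y ℤ.* (x ℤ.* z)
x∙yz≡y∙xz = solve-∀

∑-last : ∀ n (f : ℕ → ℤ) → ∑ (suc n) f ≡ ∑ n f ℤ.+ f n
∑-last zero    f = ℤₚ.+-comm (f 0) 0ℤ
∑-last (suc n) f = trans (+-congˡ (f 0) (∑-last n (f ∘ suc))) (sym (ℤₚ.+-assoc (f 0) _ _))

-- Newton expansions of powers

-- newton x n j is the coefficient of ∏_{i<j} (y - x i) in the expansion of y ^ n,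
-- i.e. the complete homogeneous symmetric polynomial of degree n - j in x 0, …, x j.
newton : (ℕ → ℤ) → ℕ → ℕ → ℤ
newton x zero    zero    = 1ℤ
newton x zero    (suc j) = 0ℤ
newton x (suc n) zero    = x 0 ℤ.* newton x n 0
newton x (suc n) (suc j) = x (suc j) ℤ.* newton x n (suc j) ℤ.+ newton x n j

newton>≡0 : ∀ x {n j} → n < j → newton x n j ≡ 0ℤ
newton>≡0 x {zero}  {suc j} _ = refl
newton>≡0 x {suc n} {suc j} (s≤s n<j) = begin
  x (suc j) ℤ.* newton x n (suc j) ℤ.+ newton x n j
    ≡⟨ cong₂ (λ u v → x (suc j) ℤ.* u ℤ.+ v) (newton>≡0 x (ℕₚ.m<n⇒m<1+n n<j)) (newton>≡0 x n<j) ⟩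
  x (suc j) ℤ.* 0ℤ ℤ.+ 0ℤ
    ≡⟨ cong (λ u → u ℤ.+ 0ℤ) (ℤₚ.*-zeroʳ (x (suc j))) ⟩
  0ℤ ∎

newton-n-n : ∀ x n → newton x n n ≡ 1ℤ
newton-n-n x zero    = refl
newton-n-n x (suc n) = begin
  x (suc n) ℤ.* newton x n (suc n) ℤ.+ newton x n n
    ≡⟨ cong₂ (λ u v → x (suc n) ℤ.* u ℤ.+ v) (newton>≡0 x (ℕₚ.n<1+n n)) (newton-n-n x n) ⟩
  x (suc n) ℤ.* 0ℤ ℤ.+ 1ℤ
    ≡⟨ cong (λ u → u ℤ.+ 1ℤ) (ℤₚ.*-zeroʳ (x (suc n))) ⟩
  1ℤ ∎

newton-n-0 : ∀ x n → newton x n 0 ≡ x 0 ℤ.^ n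
newton-n-0 x zero    = refl
newton-n-0 x (suc n) = *-congˡ (x 0) (newton-n-0 x n)

-- Sequences F j with F j = (E - x (j-1)) ⋯ (E - x 0) F 0, where E shifts a sequence.
newton-expand : ∀ x (F : ℕ → ℕ → ℤ) → (∀ j l → F j (suc l) ≡ x j ℤ.* F j l ℤ.+ F (suc j) l) →
  ∀ n l N → n < N → F 0 (n + l) ≡ ∑ N (λ j → newton x n j ℤ.* F j l)
newton-expand x F rec zero l (suc N) _ = sym (begin
  1ℤ ℤ.* F 0 l ℤ.+ ∑ N (λ j → 0ℤ ℤ.* F (suc j) l)
    ≡⟨ cong₂ ℤ._+_ (ℤₚ.*-identityˡ (F 0 l)) (∑-zero N λ _ _ → refl) ⟩
  F 0 l ℤ.+ 0ℤ
    ≡⟨ ℤₚ.+-identityʳ _ ⟩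
  F 0 l ∎)
newton-expand x F rec (suc n) l (suc N) (s≤s n<N) = begin
  F 0 (suc n + l)
    ≡⟨ cong (F 0) (ℕₚ.+-suc n l) ⟨
  F 0 (n + suc l)
    ≡⟨ newton-expand x F rec n (suc l) (suc N) (ℕₚ.m<n⇒m<1+n n<N) ⟩
  ∑ (suc N) (λ j → newton x n j ℤ.* F j (suc l))
    ≡⟨ ∑-cong (suc N) (λ j → trans (*-congˡ (newton x n j) (rec j l)) (distrib (newton x n j) (x j) (F j l) (F (suc j) l))) ⟩
  ∑ (suc N) (λ j → u j ℤ.+ v j)
    ≡⟨ ∑-distrib-+ (suc N) u v ⟩
  -- The sum of `v` is to be reindexed by one and merged with that of `u` by the recursion of
  -- `newton`. Its last term drops out since `newton x n N` is zero for `n < N`.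
  (u 0 ℤ.+ ∑ N (u ∘ suc)) ℤ.+ ∑ (suc N) v
    ≡⟨ cong (λ z → u 0 ℤ.+ ∑ N (u ∘ suc) ℤ.+ z) (∑-last N v) ⟩
  (u 0 ℤ.+ ∑ N (u ∘ suc)) ℤ.+ (∑ N v ℤ.+ v N)
    ≡⟨ cong (λ z → u 0 ℤ.+ ∑ N (u ∘ suc) ℤ.+ (∑ N v ℤ.+ z ℤ.* F (suc N) l)) (newton>≡0 x n<N) ⟩
  (u 0 ℤ.+ ∑ N (u ∘ suc)) ℤ.+ (∑ N v ℤ.+ 0ℤ)
    ≡⟨ regroup (u 0) (∑ N (u ∘ suc)) (∑ N v) ⟩
  u 0 ℤ.+ (∑ N (u ∘ suc) ℤ.+ ∑ N v)
    ≡⟨ +-congˡ (u 0) (∑-distrib-+ N (u ∘ suc) v) ⟨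
  u 0 ℤ.+ ∑ N (λ j → u (suc j) ℤ.+ v j)
    ≡⟨ +-congˡ (u 0) (∑-cong N λ j → ℤₚ.*-distribʳ-+ (F (suc j) l) (x (suc j) ℤ.* newton x n (suc j)) (newton x n j)) ⟨
  ∑ (suc N) (λ j → newton x (suc n) j ℤ.* F j l) ∎
  where
  u v : ℕ → ℤ
  u j = x j ℤ.* newton x n j ℤ.* F j l
  v j = newton x n j ℤ.* F (suc j) l
  distrib : ∀ g x a b → g ℤ.* (x ℤ.* a ℤ.+ b) ≡ x ℤ.* g ℤ.* a ℤ.+ g ℤ.* b
  distrib = solve-∀
  regroup : ∀ a b c → (a ℤ.+ b) ℤ.+ (c ℤ.+ 0ℤ) ≡ a ℤ.+ (b ℤ.+ c)
  regroup = solve-∀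

∏-diff : (ℕ → ℤ) → ℤ → ℕ → ℤ
∏-diff x y zero    = 1ℤ
∏-diff x y (suc j) = ∏-diff x y j ℤ.* (y ℤ.- x j)

-- The case of `newton-expand` where `F j l` is `y ^ l` times the product of the `y - x i` for
-- `i < j`; its recursion is `y = x j + (y - x j)`.
newton-eval : ∀ x y n N → n < N → y ℤ.^ n ≡ ∑ N (λ j → newton x n j ℤ.* ∏-diff x y j)
newton-eval x y n N n<N = begin
  y ℤ.^ n                                              ≡⟨ ℤₚ.*-identityʳ _ ⟨
  y ℤ.^ n ℤ.* 1ℤ                                       ≡⟨ cong (λ z → y ℤ.^ z ℤ.* 1ℤ) (ℕₚ.+-identityʳ n) ⟨
  F 0 (n + 0)                                          ≡⟨ newton-expand x F rec n 0 N n<N ⟩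
  ∑ N (λ j → newton x n j ℤ.* (1ℤ ℤ.* ∏-diff x y j))   ≡⟨ ∑-cong N (λ j → *-congˡ (newton x n j) (ℤₚ.*-identityˡ _)) ⟩
  ∑ N (λ j → newton x n j ℤ.* ∏-diff x y j)            ∎
  where
  F : ℕ → ℕ → ℤ
  F j l = y ℤ.^ l ℤ.* ∏-diff x y j
  rec : ∀ j l → F j (suc l) ≡ x j ℤ.* F j l ℤ.+ F (suc j) l
  rec j l = split y (x j) (y ℤ.^ l) (∏-diff x y j)
    where
    split : ∀ y x a b → y ℤ.* a ℤ.* b ≡ x ℤ.* (a ℤ.* b) ℤ.+ a ℤ.* (b ℤ.* (y ℤ.- x))
    split = solve-∀

newton-eval-- : ∀ x y n n′ N → n < N → n′ < N →
  ∑ N (λ j → (newton x n j ℤ.- newton x n′ j) ℤ.* ∏-diff x y j) ≡ y ℤ.^ n ℤ.- y ℤ.^ n′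
newton-eval-- x y n n′ N n<N n′<N = begin
  ∑ N (λ j → (newton x n j ℤ.- newton x n′ j) ℤ.* ∏-diff x y j)
    ≡⟨ ∑-cong N (λ j → distrib (newton x n j) (newton x n′ j) (∏-diff x y j)) ⟩
  ∑ N (λ j → f n j ℤ.+ -1ℤ ℤ.* f n′ j)
    ≡⟨ ∑-distrib-+ N (f n) (λ j → -1ℤ ℤ.* f n′ j) ⟩
  ∑ N (f n) ℤ.+ ∑ N (λ j → -1ℤ ℤ.* f n′ j)
    ≡⟨ +-congˡ (∑ N (f n)) (∑-distribˡ-* N -1ℤ (f n′)) ⟩
  ∑ N (f n) ℤ.+ -1ℤ ℤ.* ∑ N (f n′)
    ≡⟨ cong₂ (λ u v → u ℤ.+ -1ℤ ℤ.* v) (newton-eval x y n N n<N) (newton-eval x y n′ N n′<N) ⟨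
  y ℤ.^ n ℤ.+ -1ℤ ℤ.* y ℤ.^ n′
    ≡⟨ +-congˡ (y ℤ.^ n) (ℤₚ.-1*i≡-i (y ℤ.^ n′)) ⟩
  y ℤ.^ n ℤ.- y ℤ.^ n′ ∎
  where
  f : ℕ → ℕ → ℤ
  f n j = newton x n j ℤ.* ∏-diff x y j
  distrib : ∀ a c e → (a ℤ.- c) ℤ.* e ≡ a ℤ.* e ℤ.+ -1ℤ ℤ.* (c ℤ.* e)
  distrib = solve-∀

∏-diff-node : ∀ x {k j} → k < j → ∏-diff x (x k) j ≡ 0ℤ
∏-diff-node x {k} {suc j} (s≤s k≤j) with k ℕ.≟ j
... | yes refl = trans (*-congˡ (∏-diff x (x k) k) (ℤₚ.+-inverseʳ (x k))) (ℤₚ.*-zeroʳ (∏-diff x (x k) k))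
... | no  k≢j  = cong (λ z → z ℤ.* (x k ℤ.- x j)) (∏-diff-node x (ℕₚ.≤∧≢⇒< k≤j k≢j))

-- The falling factorial (i)_j, seen as the Newton basis polynomial on the nodes 0, 1, 2, ....
ff : ℕ → ℕ → ℤ
ff i = ∏-diff (λ k → + k) (+ i)

ff<≡0 : ∀ {i j} → i < j → ff i j ≡ 0ℤ
ff<≡0 = ∏-diff-node (λ k → + k)

ff-suc : ∀ i j → ff (suc i) (suc j) ≡ + suc i ℤ.* ff i j
ff-suc i zero    = trans (ℤₚ.*-identityˡ (+ suc i ℤ.- 0ℤ)) (trans (ℤₚ.+-identityʳ (+ suc i)) (sym (ℤₚ.*-identityʳ (+ suc i))))
ff-suc i (suc j) = trans (cong₂ ℤ._*_ (ff-suc i j) (shift (+ i) (+ j))) (ℤₚ.*-assoc (+ suc i) (ff i j) (+ i ℤ.- + j))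
  where
  shift : ∀ i j → (1ℤ ℤ.+ i) ℤ.- (1ℤ ℤ.+ j) ≡ i ℤ.- j
  shift = solve-∀

ff-n-n : ∀ n → ff n n ≡ + (n !)
ff-n-n zero    = refl
ff-n-n (suc n) = trans (ff-suc n n) (trans (*-congˡ (+ suc n) (ff-n-n n)) (sym (ℤₚ.pos-* (suc n) (n !))))

∏-diff-translate : ∀ a i j → ∏-diff (λ k → + k ℤ.- a) (+ i ℤ.- a) j ≡ ff i j
∏-diff-translate a i zero    = refl
∏-diff-translate a i (suc j) = cong₂ ℤ._*_ (∏-diff-translate a i j) (cancel (+ i) (+ j) a)
  where
  cancel : ∀ i j a → (i ℤ.- a) ℤ.- (j ℤ.- a) ≡ i ℤ.- j
  cancel = solve-∀

pos-+-* : ∀ r i q → + (r + i * q) ≡ + r ℤ.+ + i ℤ.* + q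
pos-+-* r i q = trans (ℤₚ.pos-+ r (i * q)) (+-congˡ (+ r) (ℤₚ.pos-* i q))

-- Binomial sums over a residue class

-- Each block of `q` consecutive indices contains exactly one index in the class of `r`, and so do
-- the `r + s + 1` indices that remain after `m` blocks.
∑-residue : ∀ q r s m (f : ℕ → ℤ) → r < q → s < q →
  (∀ c i → c < q → c ≢ r → f (c + i * q) ≡ 0ℤ) →
  ∑ (suc (r + s + m * q)) f ≡ ∑ (suc m) (λ i → f (r + i * q))
∑-residue q r s zero f r<q s<q z = begin
  ∑ (suc (r + s + 0)) f    ≡⟨ cong (λ n → ∑ (suc n) f) (ℕₚ.+-identityʳ (r + s)) ⟩
  ∑ (suc (r + s)) f        ≡⟨ ∑-single (suc (r + s)) r f (s≤s (ℕₚ.m≤m+n r s)) zeros ⟩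
  f r                      ≡⟨ cong f (ℕₚ.+-identityʳ r) ⟨
  f (r + 0)                ≡⟨ ℤₚ.+-identityʳ _ ⟨
  f (r + 0) ℤ.+ 0ℤ         ∎
  where
  zeros : ∀ k → k < suc (r + s) → k ≢ r → f k ≡ 0ℤ
  zeros k (s≤s k≤r+s) k≢r with k ℕₚ.<? q
  ... | yes k<q = trans (cong f (sym (ℕₚ.+-identityʳ k))) (z k 0 k<q k≢r)
  -- Here `k ≤ r + s < r + q`, so `k ∸ q` is a residue strictly below `r`, hence different from it.
  ... | no  k≮q = trans (cong f (sym k∸q+q)) (z (k ∸ q) 1 (ℕₚ.<-trans k∸q<r r<q) (ℕₚ.<⇒≢ k∸q<r))
    where
    q≤k = ℕₚ.≮⇒≥ k≮q
    k∸q+q : k ∸ q + 1 * q ≡ k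
    k∸q+q = trans (cong (λ z → k ∸ q + z) (ℕₚ.*-identityˡ q)) (ℕₚ.m∸n+n≡m q≤k)
    k∸q<r : k ∸ q < r
    k∸q<r = ℕₚ.+-cancelʳ-< q (k ∸ q) r (subst (_< r + q) (sym (ℕₚ.m∸n+n≡m q≤k))
      (ℕₚ.≤-<-trans k≤r+s (ℕₚ.+-monoʳ-< r s<q)))
∑-residue q r s (suc m) f r<q s<q z = begin
  ∑ (suc (r + s + (q + m * q))) f
    ≡⟨ cong (λ n → ∑ n f) shift ⟩
  ∑ (q + suc (r + s + m * q)) f
    ≡⟨ ∑-split q (suc (r + s + m * q)) f ⟩
  ∑ q f ℤ.+ ∑ (suc (r + s + m * q)) (λ k → f (q + k))
    ≡⟨ cong₂ ℤ._+_
         (trans (∑-single q r f r<q λ c c<q c≢r → trans (cong f (sym (ℕₚ.+-identityʳ c))) (z c 0 c<q c≢r))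
                (cong f (sym (ℕₚ.+-identityʳ r))))
         (∑-residue q r s m (λ k → f (q + k)) r<q s<q λ c i c<q c≢r → trans (cong f (swap c i)) (z c (suc i) c<q c≢r)) ⟩
  f (r + 0) ℤ.+ ∑ (suc m) (λ i → f (q + (r + i * q)))
    ≡⟨ +-congˡ (f (r + 0)) (∑-cong (suc m) λ i → cong f (swap r i)) ⟩
  ∑ (suc (suc m)) (λ i → f (r + i * q)) ∎
  where
  swap : ∀ c i → q + (c + i * q) ≡ c + (q + i * q)
  swap c i = trans (sym (ℕₚ.+-assoc q c _)) (trans (cong (λ z → z + i * q) (ℕₚ.+-comm q c)) (ℕₚ.+-assoc c q _))
  shift : suc (r + s + (q + m * q)) ≡ q + suc (r + s + m * q)
  shift = trans (cong suc (sym (swap (r + s) m))) (sym (ℕₚ.+-suc q _))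

-- The sum over k = r + i q of (-1)^k C(n,k) (i)_j, up to the sign (-1)^r.
T : ℕ → ℕ → ℕ → ℕ → ℕ → ℤ
T q n r m j = ∑ (suc m) (λ i → sgn (i * q) ℤ.* bin n (r + i * q) ℤ.* ff i j)

-- Split `R + i Q = (R + j Q) + (i - j) Q` and use (i)_j (i - j) = (i)_{j+1}. Leaving `R` and `Q`
-- free covers both absorption identities: `R = r`, `Q = q` lowers `r`, while `R = n - r`, `Q = - q`
-- lowers `n - r`.
T-rec : ∀ q n r n′ r′ R Q N → (∀ i → (R ℤ.+ + i ℤ.* Q) ℤ.* bin n (r + i * q) ≡ N ℤ.* bin n′ (r′ + i * q)) →
  ∀ m j → (R ℤ.+ + j ℤ.* Q) ℤ.* T q n r m j ℤ.+ Q ℤ.* T q n r m (suc j) ≡ N ℤ.* T q n′ r′ m j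
T-rec q n r n′ r′ R Q N absorb m j = begin
  A ℤ.* ∑ (suc m) (t j) ℤ.+ Q ℤ.* ∑ (suc m) (t (suc j))
    ≡⟨ cong₂ ℤ._+_ (sym (∑-distribˡ-* (suc m) A (t j))) (sym (∑-distribˡ-* (suc m) Q (t (suc j)))) ⟩
  ∑ (suc m) (λ i → A ℤ.* t j i) ℤ.+ ∑ (suc m) (λ i → Q ℤ.* t (suc j) i)
    ≡⟨ ∑-distrib-+ (suc m) (λ i → A ℤ.* t j i) (λ i → Q ℤ.* t (suc j) i) ⟨
  ∑ (suc m) (λ i → A ℤ.* t j i ℤ.+ Q ℤ.* t (suc j) i)
    ≡⟨ ∑-cong (suc m) termwise ⟩
  ∑ (suc m) (λ i → N ℤ.* t′ i)
    ≡⟨ ∑-distribˡ-* (suc m) N t′ ⟩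
  N ℤ.* ∑ (suc m) t′ ∎
  where
  A = R ℤ.+ + j ℤ.* Q
  t : ℕ → ℕ → ℤ
  t j i = sgn (i * q) ℤ.* bin n (r + i * q) ℤ.* ff i j
  t′ : ℕ → ℤ
  t′ i = sgn (i * q) ℤ.* bin n′ (r′ + i * q) ℤ.* ff i j
  collect : ∀ R J I Q s b f → (R ℤ.+ J ℤ.* Q) ℤ.* (s ℤ.* b ℤ.* f) ℤ.+ Q ℤ.* (s ℤ.* b ℤ.* (f ℤ.* (I ℤ.- J)))
    ≡ s ℤ.* ((R ℤ.+ I ℤ.* Q) ℤ.* b) ℤ.* f
  collect = solve-∀
  spread : ∀ s N b f → s ℤ.* (N ℤ.* b) ℤ.* f ≡ N ℤ.* (s ℤ.* b ℤ.* f)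
  spread = solve-∀
  termwise : ∀ i → A ℤ.* t j i ℤ.+ Q ℤ.* t (suc j) i ≡ N ℤ.* t′ i
  termwise i = trans (collect R (+ j) (+ i) Q (sgn (i * q)) (bin n (r + i * q)) (ff i j))
    (trans (cong (λ z → sgn (i * q) ℤ.* z ℤ.* ff i j) (absorb i))
      (spread (sgn (i * q)) N (bin n′ (r′ + i * q)) (ff i j)))

V : ℕ → ℕ → ℕ → ℕ → ℤ
V q n r m = + (m !) ℤ.* bin n (r + m * q)

T-top : ∀ q n r m → T q n r m m ≡ sgn (m * q) ℤ.* V q n r m
T-top q n r m = begin
  ∑ (suc m) t
    ≡⟨ ∑-single (suc m) m t (ℕₚ.n<1+n m) vanish ⟩
  sgn (m * q) ℤ.* bin n (r + m * q) ℤ.* ff m m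
    ≡⟨ *-congˡ (sgn (m * q) ℤ.* bin n (r + m * q)) (ff-n-n m) ⟩
  sgn (m * q) ℤ.* bin n (r + m * q) ℤ.* + (m !)
    ≡⟨ regroup (sgn (m * q)) (bin n (r + m * q)) (+ (m !)) ⟩
  sgn (m * q) ℤ.* V q n r m ∎
  where
  t : ℕ → ℤ
  t i = sgn (i * q) ℤ.* bin n (r + i * q) ℤ.* ff i m
  vanish : ∀ i → i < suc m → i ≢ m → t i ≡ 0ℤ
  vanish i (s≤s i≤m) i≢m = trans (*-congˡ (sgn (i * q) ℤ.* bin n (r + i * q)) (ff<≡0 (ℕₚ.≤∧≢⇒< i≤m i≢m)))
    (ℤₚ.*-zeroʳ (sgn (i * q) ℤ.* bin n (r + i * q)))
  regroup : ∀ s b f → s ℤ.* b ℤ.* f ≡ s ℤ.* (f ℤ.* b)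
  regroup = solve-∀

T>≡0 : ∀ q n r m j → m < j → T q n r m j ≡ 0ℤ
T>≡0 q n r m j m<j = ∑-zero (suc m) λ i i≤m →
  trans (*-congˡ (sgn (i * q) ℤ.* bin n (r + i * q)) (ff<≡0 (ℕₚ.<-≤-trans i≤m m<j)))
    (ℤₚ.*-zeroʳ (sgn (i * q) ℤ.* bin n (r + i * q)))

-- The term at i = 0 vanishes. In the others (i+1)_{j+1} = (i+1) (i)_j, and the factor i + 1 is
-- absorbed into the binomial after multiplying by `q`, which cancels again.
T-00 : ∀ q .{{_ : ℕ.NonZero q}} m j → T q (suc m * q) 0 (suc m) (suc j)
  ≡ sgn q ℤ.* + suc m ℤ.* T q (ℕ.pred q + m * q) (ℕ.pred q) m j
T-00 q@(suc q′) m j = begin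
  t 0 ℤ.+ ∑ (suc m) (t ∘ suc)
    ≡⟨ cong₂ ℤ._+_ (trans (*-congˡ (sgn 0 ℤ.* bin N 0) (ff<≡0 {0} {suc j} (s≤s z≤n))) (ℤₚ.*-zeroʳ (sgn 0 ℤ.* bin N 0)))
                   (∑-cong (suc m) termwise) ⟩
  0ℤ ℤ.+ ∑ (suc m) (λ i → c ℤ.* t′ i)
    ≡⟨ ℤₚ.+-identityˡ _ ⟩
  ∑ (suc m) (λ i → c ℤ.* t′ i)
    ≡⟨ ∑-distribˡ-* (suc m) c t′ ⟩
  c ℤ.* ∑ (suc m) t′ ∎
  where
  n N : ℕ
  n = q′ + m * q
  N = suc m * q
  c : ℤ
  c = sgn q ℤ.* + suc m
  t t′ : ℕ → ℤ
  t i = sgn (i * q) ℤ.* bin N (i * q) ℤ.* ff i (suc j)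
  t′ i = sgn (i * q) ℤ.* bin n (q′ + i * q) ℤ.* ff i j
  absorb : ∀ i → + suc i ℤ.* bin N (suc i * q) ≡ + suc m ℤ.* bin n (q′ + i * q)
  absorb i = ℤₚ.*-cancelˡ-≡ (+ q) _ _ (begin
    + q ℤ.* (+ suc i ℤ.* bin N (suc i * q))    ≡⟨ regroup (+ q) (+ suc i) (bin N (suc i * q)) ⟩
    + suc i ℤ.* + q ℤ.* bin N (suc i * q)      ≡⟨ cong (λ z → z ℤ.* bin N (suc i * q)) (ℤₚ.pos-* (suc i) q) ⟨
    + (suc i * q) ℤ.* bin N (suc i * q)        ≡⟨ bin-absorb n (q′ + i * q) ⟩
    + (suc m * q) ℤ.* bin n (q′ + i * q)       ≡⟨ cong (λ z → z ℤ.* bin n (q′ + i * q)) (ℤₚ.pos-* (suc m) q) ⟩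
    + suc m ℤ.* + q ℤ.* bin n (q′ + i * q)     ≡⟨ regroup (+ q) (+ suc m) (bin n (q′ + i * q)) ⟨
    + q ℤ.* (+ suc m ℤ.* bin n (q′ + i * q))   ∎)
    where
    regroup : ∀ q i b → q ℤ.* (i ℤ.* b) ≡ i ℤ.* q ℤ.* b
    regroup = solve-∀
  collect : ∀ s u b i f → s ℤ.* u ℤ.* b ℤ.* (i ℤ.* f) ≡ s ℤ.* u ℤ.* (i ℤ.* b) ℤ.* f
  collect = solve-∀
  spread : ∀ s u b m f → s ℤ.* u ℤ.* (m ℤ.* b) ℤ.* f ≡ s ℤ.* m ℤ.* (u ℤ.* b ℤ.* f)
  spread = solve-∀
  termwise : ∀ i → t (suc i) ≡ c ℤ.* t′ i
  termwise i = begin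
    sgn (q + i * q) ℤ.* bin N (suc i * q) ℤ.* ff (suc i) (suc j)
      ≡⟨ cong₂ (λ u v → u ℤ.* bin N (suc i * q) ℤ.* v) (ℤₚ.^-distribˡ-+-* -1ℤ q (i * q)) (ff-suc i j) ⟩
    sgn q ℤ.* sgn (i * q) ℤ.* bin N (suc i * q) ℤ.* (+ suc i ℤ.* ff i j)
      ≡⟨ collect (sgn q) (sgn (i * q)) (bin N (suc i * q)) (+ suc i) (ff i j) ⟩
    sgn q ℤ.* sgn (i * q) ℤ.* (+ suc i ℤ.* bin N (suc i * q)) ℤ.* ff i j
      ≡⟨ cong (λ z → sgn q ℤ.* sgn (i * q) ℤ.* z ℤ.* ff i j) (absorb i) ⟩
    sgn q ℤ.* sgn (i * q) ℤ.* (+ suc m ℤ.* bin n (q′ + i * q)) ℤ.* ff i j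
      ≡⟨ spread (sgn q) (sgn (i * q)) (bin n (q′ + i * q)) (+ suc m) (ff i j) ⟩
    c ℤ.* t′ i ∎

-- Integer division and rational congruences

mod⁺< : ∀ x d .{{_ : ℕ.NonZero d}} → x mod⁺ d < d
mod⁺< x (suc d) = ℤ/.n%ℕd<d x (suc d)

mod⁺-div⁺ : ∀ x d .{{_ : ℕ.NonZero d}} → x ≡ + (x mod⁺ d) ℤ.+ (x div⁺ d) ℤ.* + d
mod⁺-div⁺ x (suc d) = ℤ/.a≡a%ℕn+[a/ℕn]*n x (suc d)

mod⁺-unique : ∀ c i d .{{_ : ℕ.NonZero d}} → c < d → (+ (c + i * d)) mod⁺ d ≡ c
mod⁺-unique c i d@(suc _) c<d = trans (ℕ/.[m+kn]%n≡m%n c i d) (ℕ/.m<n⇒m%n≡m c<d)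

ndiv⁺-unique : ∀ c i d .{{_ : ℕ.NonZero d}} → c < d → (c + i * d) ndiv⁺ d ≡ i
ndiv⁺-unique c i d@(suc _) c<d = trans (ℕ/.+-distrib-/-∣ʳ c (ℕ∣.divides i refl))
  (cong₂ _+_ (ℕ/.m<n⇒m/n≡0 c<d) (ℕ/.m*n/n≡m i d))

-- With `y` the quotient, `(z - y) * d` equals the remainder. If `z - y` were nonzero, this would be
-- at least `d` in absolute value.
div⁺-multiple : ∀ z d .{{_ : ℕ.NonZero d}} → (z ℤ.* + d) div⁺ d ≡ z
div⁺-multiple z d = sym (ℤₚ.i-j≡0⇒i≡j z y (ℤₚ.∣i∣≡0⇒i≡0 (∣z-y∣≡0 ℤ.∣ z ℤ.- y ∣ refl)))
  where
  y = (z ℤ.* + d) div⁺ d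
  ρ = (z ℤ.* + d) mod⁺ d
  [z-y]d : (z ℤ.- y) ℤ.* + d ≡ + ρ
  [z-y]d = begin
    (z ℤ.- y) ℤ.* + d                       ≡⟨ distrib z y (+ d) ⟩
    z ℤ.* + d ℤ.- y ℤ.* + d                 ≡⟨ cong (λ x → x ℤ.- y ℤ.* + d) (mod⁺-div⁺ (z ℤ.* + d) d) ⟩
    + ρ ℤ.+ y ℤ.* + d ℤ.- y ℤ.* + d         ≡⟨ cancel (+ ρ) (y ℤ.* + d) ⟩
    + ρ                                     ∎
    where
    distrib : ∀ z y d → (z ℤ.- y) ℤ.* d ≡ z ℤ.* d ℤ.- y ℤ.* d
    distrib = solve-∀
    cancel : ∀ a b → a ℤ.+ b ℤ.- b ≡ a
    cancel = solve-∀
  ∣z-y∣≡0 : ∀ k → ℤ.∣ z ℤ.- y ∣ ≡ k → k ≡ 0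
  ∣z-y∣≡0 zero    _ = refl
  ∣z-y∣≡0 (suc k) e = contradiction
    (subst (_< d) (trans (cong ℤ.∣_∣ (sym [z-y]d)) (trans (ℤₚ.abs-* (z ℤ.- y) (+ d)) (cong (_* d) e))) (mod⁺< (z ℤ.* + d) d))
    (ℕₚ.≤⇒≯ (ℕₚ.m≤m+n d (k * d)))

foldr-upTo : ∀ n (f : ℕ → ℤ) → foldr ℤ._+_ (+ 0) (map f (upTo n)) ≡ ∑ n f
foldr-upTo n f = trans (cong (foldr ℤ._+_ (+ 0)) (map-upTo f n)) (go n f)
  where
  go : ∀ n f → foldr ℤ._+_ (+ 0) (applyUpTo f n) ≡ ∑ n f
  go zero    f = refl
  go (suc n) f = +-congˡ (f 0) (go n (f ∘ suc))

-- Stated for arbitrary decisions, so that matching on them reduces the conditional in `δ`.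
if-∧₃ : ∀ {A B C : Set} (A? : Dec A) (B? : Dec B) (C? : Dec C) →
  let d = if does A? ∧ does B? ∧ does C? then 1 else 0 in d ≡ 0 ⊎ (d ≡ 1 × A × B × C)
if-∧₃ (no  _) _       _       = inj₁ refl
if-∧₃ (yes _) (no  _) _       = inj₁ refl
if-∧₃ (yes _) (yes _) (no  _) = inj₁ refl
if-∧₃ (yes a) (yes b) (yes c) = inj₂ (refl , a , b , c)

δ-cases : ∀ p a m e → δ p a m e ≡ 0 ⊎ (δ p a m e ≡ 1 × p ∣ ℤ.∣ a ∣ × 1 ≤ e × p ^ e ≡ m)
δ-cases p a m e = if-∧₃ (p ∣? ℤ.∣ a ∣) (1 ℕ.≤? e) (p ^ e ℕ.≟ m)

-- The equation is checked on unnormalised fractions, where it is a cross multiplication of integers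
-- and no gcd appears. The stray factors 1 in `numerators` come from the denominators there.
÷⁺-cross-multiply : ∀ S σ b c d → 0 < d → b ℤ.* (S ℤ.- σ ℤ.* + d) ≡ c ℤ.* + d →
  (S ÷⁺ d ℚ.- σ ℚ./ 1) ℚ.* (b ℚ./ 1) ≡ c ℚ./ 1
÷⁺-cross-multiply S σ b c (suc d) _ eq = ℚₚ.toℚᵘ-injective (begin-≃)
  where
  x = S ℚ./ suc d
  y = σ ℚ./ 1
  z = b ℚ./ 1
  numerators : (S ℤ.* 1ℤ ℤ.+ ℤ.- σ ℤ.* + suc d) ℤ.* b ℤ.* 1ℤ ≡ c ℤ.* + suc (d * 1 * 1)
  numerators = begin
    (S ℤ.* 1ℤ ℤ.+ ℤ.- σ ℤ.* + suc d) ℤ.* b ℤ.* 1ℤ   ≡⟨ rearrange S σ (+ suc d) b ⟩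
    b ℤ.* (S ℤ.- σ ℤ.* + suc d)                     ≡⟨ eq ⟩
    c ℤ.* + suc d                                   ≡⟨ cong (λ n → c ℤ.* + suc n) (trans (ℕₚ.*-identityʳ (d * 1)) (ℕₚ.*-identityʳ d)) ⟨
    c ℤ.* + suc (d * 1 * 1)                         ∎
    where
    rearrange : ∀ S σ d b → (S ℤ.* 1ℤ ℤ.+ ℤ.- σ ℤ.* d) ℤ.* b ℤ.* 1ℤ ≡ b ℤ.* (S ℤ.- σ ℤ.* d)
    rearrange = solve-∀
  toℚᵘ-/ : ∀ n d → ℚ.toℚᵘ (n ℚ./ suc d) ℚᵘ.≃ mkℚᵘ n d
  toℚᵘ-/ n d = ℚₚ.toℚᵘ-fromℚᵘ (mkℚᵘ n d)
  begin-≃ : ℚ.toℚᵘ ((x ℚ.- y) ℚ.* z) ℚᵘ.≃ ℚ.toℚᵘ (c ℚ./ 1)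
  begin-≃ = ℚᵘₚ.≃-trans (ℚₚ.toℚᵘ-homo-* (x ℚ.- y) z)
    (ℚᵘₚ.≃-trans (ℚᵘₚ.*-cong
      (ℚᵘₚ.≃-trans (ℚₚ.toℚᵘ-homo-+ x (ℚ.- y))
        (ℚᵘₚ.+-cong (toℚᵘ-/ S d) (ℚᵘₚ.≃-trans (ℚₚ.toℚᵘ-homo‿- y) (ℚᵘₚ.-‿cong (toℚᵘ-/ σ 0)))))
      (toℚᵘ-/ b 0))
    (ℚᵘₚ.≃-trans (*≡* numerators) (ℚᵘₚ.≃-sym (toℚᵘ-/ c 0))))

-- On the nodes `k - a` the Newton basis polynomials at `i - a` are the falling factorials of `i`;
-- expand the power and exchange the two sums.
∑-newton-T : ∀ q n r m l a →
  ∑ (suc m) (λ i → sgn (r + i * q) ℤ.* bin n (r + i * q) ℤ.* (+ i ℤ.- a) ℤ.^ l)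
    ≡ sgn r ℤ.* ∑ (suc l) (λ j → newton (λ k → + k ℤ.- a) l j ℤ.* T q n r m j)
∑-newton-T q n r m l a = begin
  ∑ (suc m) (λ i → sgn (r + i * q) ℤ.* bin n (r + i * q) ℤ.* (+ i ℤ.- a) ℤ.^ l)
    ≡⟨ ∑-cong (suc m) (λ i → trans (cong₂ (λ u v → u ℤ.* bin n (r + i * q) ℤ.* v) (ℤₚ.^-distribˡ-+-* -1ℤ r (i * q)) (expand i))
         (regroup (sgn r) (sgn (i * q)) (bin n (r + i * q)) (∑ (suc l) (λ j → h j ℤ.* ff i j)))) ⟩
  ∑ (suc m) (λ i → sgn r ℤ.* (w i ℤ.* ∑ (suc l) (λ j → h j ℤ.* ff i j)))
    ≡⟨ ∑-distribˡ-* (suc m) (sgn r) (λ i → w i ℤ.* ∑ (suc l) (λ j → h j ℤ.* ff i j)) ⟩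
  sgn r ℤ.* ∑ (suc m) (λ i → w i ℤ.* ∑ (suc l) (λ j → h j ℤ.* ff i j))
    ≡⟨ *-congˡ (sgn r) (∑-cong (suc m) λ i → trans (sym (∑-distribˡ-* (suc l) (w i) (λ j → h j ℤ.* ff i j)))
         (∑-cong (suc l) λ j → swap (w i) (h j) (ff i j))) ⟩
  sgn r ℤ.* ∑ (suc m) (λ i → ∑ (suc l) (λ j → h j ℤ.* (w i ℤ.* ff i j)))
    ≡⟨ *-congˡ (sgn r) (∑-swap (suc m) (suc l) (λ i j → h j ℤ.* (w i ℤ.* ff i j))) ⟩
  sgn r ℤ.* ∑ (suc l) (λ j → ∑ (suc m) (λ i → h j ℤ.* (w i ℤ.* ff i j)))
    ≡⟨ *-congˡ (sgn r) (∑-cong (suc l) λ j → ∑-distribˡ-* (suc m) (h j) (λ i → w i ℤ.* ff i j)) ⟩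
  sgn r ℤ.* ∑ (suc l) (λ j → h j ℤ.* T q n r m j) ∎
  where
  h : ℕ → ℤ
  h = newton (λ k → + k ℤ.- a) l
  w : ℕ → ℤ
  w i = sgn (i * q) ℤ.* bin n (r + i * q)
  regroup : ∀ s u b x → s ℤ.* u ℤ.* b ℤ.* x ≡ s ℤ.* (u ℤ.* b ℤ.* x)
  regroup = solve-∀
  swap : ∀ w h f → w ℤ.* (h ℤ.* f) ≡ h ℤ.* (w ℤ.* f)
  swap = solve-∀
  expand : ∀ i → (+ i ℤ.- a) ℤ.^ l ≡ ∑ (suc l) (λ j → h j ℤ.* ff i j)
  expand i = trans (newton-eval (λ k → + k ℤ.- a) (+ i ℤ.- a) l (suc l) (ℕₚ.n<1+n l))
    (∑-cong (suc l) λ j → *-congˡ (h j) (∏-diff-translate a i j))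

C>0 : ∀ r s → 0 < (r + s) C r
C>0 zero    s = s≤s z≤n
C>0 (suc r) s = subst (0 <_) (nCk+nC[k+1]≡[n+1]C[k+1] (r + s) r) (ℕₚ.m≤n⇒m≤n+o _ (C>0 r s))

-- Congruence modulo p and divisibility in ℤ₍ₚ₎

module ModPrime (p : ℕ) (p-prime : Prime p) where

  P : ℤ
  P = + p

  instance
    p≢0 : ℕ.NonZero p
    p≢0 = prime⇒nonZero p-prime

  1<p : 1 < p
  1<p = ℕ.nonTrivial⇒n>1 p {{prime⇒nonTrivial p-prime}}

  p≡1+[p∸1] : p ≡ suc (p ∸ 1)
  p≡1+[p∸1] = sym (ℕₚ.m+[n∸m]≡n (ℕₚ.<⇒≤ 1<p))

  P∤1 : ¬ P ∣ℤ 1ℤ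
  P∤1 P∣1 = ℕₚ.<⇒≱ 1<p (ℕ∣.∣⇒≤ (ℤ∣.∣⇒∣ᵤ P∣1))

  P-euclid : ∀ a b → P ∣ℤ a ℤ.* b → P ∣ℤ a ⊎ P ∣ℤ b
  P-euclid a b P∣ab = map-⊎ ℤ∣.∣ᵤ⇒∣ ℤ∣.∣ᵤ⇒∣
    (euclidsLemma ℤ.∣ a ∣ ℤ.∣ b ∣ p-prime (subst (p ℕ∣.∣_) (ℤₚ.abs-* a b) (ℤ∣.∣⇒∣ᵤ P∣ab)))

  P∤-* : ∀ {a b} → ¬ P ∣ℤ a → ¬ P ∣ℤ b → ¬ P ∣ℤ a ℤ.* b
  P∤-* {a} {b} P∤a P∤b = [ P∤a , P∤b ]′ ∘ P-euclid a b

  P∤-small : ∀ {t} → 0 < t → t < p → ¬ P ∣ℤ + t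
  P∤-small {suc t} _ t<p P∣t = ℕₚ.<⇒≱ t<p (ℕ∣.∣⇒≤ (ℤ∣.∣⇒∣ᵤ P∣t))

  P∤+multiple : ∀ {a} c → ¬ P ∣ℤ a → ¬ P ∣ℤ a ℤ.+ P ℤ.* c
  P∤+multiple {a} c P∤a P∣ = P∤a (ℤ∣.∣m+n∣n⇒∣m P∣ (ℤ∣.∣m⇒∣m*n c ℤ∣.∣-refl))

  infix 4 _≈_
  -- A record, so that `x` and `y` can be inferred from the type; they cannot be recovered from the
  -- difference alone.
  record _≈_ (x y : ℤ) : Set where
    constructor mod
    field unmod : P ∣ℤ x ℤ.- y
  open _≈_ public

  ≈-reflexive : ∀ {x y} → x ≡ y → x ≈ y
  ≈-reflexive {x} refl = mod (subst (P ∣ℤ_) (sym (ℤₚ.+-inverseʳ x)) (divides 0ℤ refl))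

  ≈-refl : ∀ {x} → x ≈ x
  ≈-refl = ≈-reflexive refl

  ≈-sym : ∀ {x y} → x ≈ y → y ≈ x
  ≈-sym {x} {y} (mod d) = mod (subst (P ∣ℤ_) (flip x y) (ℤ∣.∣m⇒∣-m d))
    where
    flip : ∀ x y → ℤ.- (x ℤ.- y) ≡ y ℤ.- x
    flip = solve-∀

  ≈-trans : ∀ {x y z} → x ≈ y → y ≈ z → x ≈ z
  ≈-trans {x} {y} {z} (mod d) (mod e) = mod (subst (P ∣ℤ_) (ℤₚ.+-minus-telescope x y z) (ℤ∣.∣m∣n⇒∣m+n d e))

  ≈-+ : ∀ {x y u v} → x ≈ y → u ≈ v → x ℤ.+ u ≈ y ℤ.+ v
  ≈-+ {x} {y} {u} {v} (mod d) (mod e) = mod (subst (P ∣ℤ_) (regroup x y u v) (ℤ∣.∣m∣n⇒∣m+n d e))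
    where
    regroup : ∀ x y u v → (x ℤ.- y) ℤ.+ (u ℤ.- v) ≡ (x ℤ.+ u) ℤ.- (y ℤ.+ v)
    regroup = solve-∀

  ≈-* : ∀ {x y u v} → x ≈ y → u ≈ v → x ℤ.* u ≈ y ℤ.* v
  ≈-* {x} {y} {u} {v} (mod d) (mod e) = mod (subst (P ∣ℤ_) (regroup x y u v)
    (ℤ∣.∣m∣n⇒∣m+n (ℤ∣.∣m⇒∣m*n u d) (ℤ∣.∣n⇒∣m*n y e)))
    where
    regroup : ∀ x y u v → (x ℤ.- y) ℤ.* u ℤ.+ y ℤ.* (u ℤ.- v) ≡ x ℤ.* u ℤ.- y ℤ.* v
    regroup = solve-∀

  ≈-neg : ∀ {x y} → x ≈ y → ℤ.- x ≈ ℤ.- y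
  ≈-neg {x} {y} (mod d) = mod (subst (P ∣ℤ_) (ℤₚ.neg-distrib-+ x (ℤ.- y)) (ℤ∣.∣m⇒∣-m d))

  ≈-- : ∀ {x y u v} → x ≈ y → u ≈ v → x ℤ.- u ≈ y ℤ.- v
  ≈-- e f = ≈-+ e (≈-neg f)

  ≈-^ : ∀ {x y} n → x ≈ y → x ℤ.^ n ≈ y ℤ.^ n
  ≈-^ zero    e = ≈-refl
  ≈-^ (suc n) e = ≈-* e (≈-^ n e)

  ∣⇒≈0 : ∀ {x} → P ∣ℤ x → x ≈ 0ℤ
  ∣⇒≈0 {x} d = mod (subst (P ∣ℤ_) (sym (ℤₚ.+-identityʳ x)) d)

  ≈0⇒∣ : ∀ {x} → x ≈ 0ℤ → P ∣ℤ x
  ≈0⇒∣ {x} (mod d) = subst (P ∣ℤ_) (ℤₚ.+-identityʳ x) d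

  -- Loc A x says x ∈ A ℤ₍ₚ₎.
  Loc : ℤ → ℤ → Set
  Loc A x = ∃ λ u → (¬ P ∣ℤ u) × A ∣ℤ u ℤ.* x

  ∣⇒Loc : ∀ {A x} → A ∣ℤ x → Loc A x
  ∣⇒Loc {A} {x} d = 1ℤ , P∤1 , subst (A ∣ℤ_) (sym (ℤₚ.*-identityˡ x)) d

  Loc-0 : ∀ {A} → Loc A 0ℤ
  Loc-0 = ∣⇒Loc (divides 0ℤ refl)

  Loc-+ : ∀ {A x y} → Loc A x → Loc A y → Loc A (x ℤ.+ y)
  Loc-+ {A} {x} {y} (u , P∤u , d) (v , P∤v , e) = u ℤ.* v , P∤-* P∤u P∤v ,
    subst (A ∣ℤ_) (regroup u v x y) (ℤ∣.∣m∣n⇒∣m+n (ℤ∣.∣n⇒∣m*n v d) (ℤ∣.∣n⇒∣m*n u e))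
    where
    regroup : ∀ u v x y → v ℤ.* (u ℤ.* x) ℤ.+ u ℤ.* (v ℤ.* y) ≡ u ℤ.* v ℤ.* (x ℤ.+ y)
    regroup = solve-∀

  Loc-* : ∀ {A x} c → Loc A x → Loc A (c ℤ.* x)
  Loc-* {A} {x} c (u , P∤u , d) = u , P∤u , subst (A ∣ℤ_) (x∙yz≡y∙xz c u x) (ℤ∣.∣n⇒∣m*n c d)

  Loc-scale : ∀ {A x} c → Loc A x → Loc (c ℤ.* A) (c ℤ.* x)
  Loc-scale {A} {x} c (u , P∤u , d) = u , P∤u , subst (c ℤ.* A ∣ℤ_) (x∙yz≡y∙xz c u x) (ℤ∣.*-monoʳ-∣ c d)

  Loc-trans : ∀ {A B x} → Loc A B → Loc B x → Loc A x
  Loc-trans {A} {B} {x} (u , P∤u , d) (v , P∤v , e) = u ℤ.* v , P∤-* P∤u P∤v ,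
    subst (A ∣ℤ_) (sym (ℤₚ.*-assoc u v x)) (ℤ∣.∣-trans d (ℤ∣.*-monoʳ-∣ u e))

  Loc-cancel-unit : ∀ {A x} v → ¬ P ∣ℤ v → Loc A (v ℤ.* x) → Loc A x
  Loc-cancel-unit {A} {x} v P∤v (u , P∤u , d) =
    u ℤ.* v , P∤-* P∤u P∤v , subst (A ∣ℤ_) (sym (ℤₚ.*-assoc u v x)) d

  Loc-cancel : ∀ {A x} c .{{_ : ℤ.NonZero c}} → Loc (c ℤ.* A) (c ℤ.* x) → Loc A x
  Loc-cancel {A} {x} c (u , P∤u , d) = u , P∤u ,
    ℤ∣.*-cancelˡ-∣ c (subst (c ℤ.* A ∣ℤ_) (x∙yz≡y∙xz u c x) d)

  -- Prime powers, the Frobenius congruence and Fermat's little theorem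

  p^ : ℕ → ℤ
  p^ α = + (p ^ α)

  p^-suc : ∀ α → p^ (suc α) ≡ P ℤ.* p^ α
  p^-suc α = ℤₚ.pos-* p (p ^ α)

  -- Since `0 < t < p ^ α`, the valuation of `t` is below `α`, so p^α / t = p c / u lies in p ℤ₍ₚ₎.
  -- The recursion strips factors `p` from `t`, and `u` is what remains.
  p-part : ∀ α t → 0 < t → t < p ^ α →
    ∃ λ u → ∃ λ c → (¬ P ∣ℤ u) × p^ α ℤ.* u ≡ P ℤ.* c ℤ.* + t
  p-part zero    (suc t) _ (s≤s ())
  p-part (suc α) t 0<t t<q with p ℕ∣.∣? t
  ... | no p∤t = + t , p^ α , p∤t ∘ ℤ∣.∣⇒∣ᵤ , cong (λ z → z ℤ.* + t) (p^-suc α)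
  ... | yes (ℕ∣.divides zero refl) = contradiction 0<t λ ()
  ... | yes (ℕ∣.divides t′@(suc _) refl) =
    let u , c , P∤u , eq = p-part α t′ (s≤s z≤n) (ℕₚ.*-cancelˡ-< p t′ (p ^ α) (subst (_< p ^ suc α) (ℕₚ.*-comm t′ p) t<q))
    in u , c , P∤u , (begin
      p^ (suc α) ℤ.* u             ≡⟨ cong (λ z → z ℤ.* u) (p^-suc α) ⟩
      P ℤ.* p^ α ℤ.* u             ≡⟨ ℤₚ.*-assoc P (p^ α) u ⟩
      P ℤ.* (p^ α ℤ.* u)           ≡⟨ *-congˡ P eq ⟩
      P ℤ.* (P ℤ.* c ℤ.* + t′)     ≡⟨ regroup P c (+ t′) ⟩
      P ℤ.* c ℤ.* (+ t′ ℤ.* P)     ≡⟨ *-congˡ (P ℤ.* c) (ℤₚ.pos-* t′ p) ⟨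
      P ℤ.* c ℤ.* + (t′ * p)       ∎)
    where
    regroup : ∀ p c t → p ℤ.* (p ℤ.* c ℤ.* t) ≡ p ℤ.* c ℤ.* (t ℤ.* p)
    regroup = solve-∀

  p^-gauss : ∀ α x y → ¬ P ∣ℤ y → p^ α ∣ℤ x ℤ.* y → p^ α ∣ℤ x
  p^-gauss zero    x y P∤y d = divides x (sym (ℤₚ.*-identityʳ x))
  p^-gauss (suc α) x y P∤y d with P-euclid x y (ℤ∣.∣-trans (divides (p^ α) (trans (p^-suc α) (ℤₚ.*-comm P (p^ α)))) d)
  ... | inj₂ P∣y = contradiction P∣y P∤y
  ... | inj₁ (divides x′ refl) =
    subst₂ _∣ℤ_ (sym (p^-suc α)) (ℤₚ.*-comm P x′) $ ℤ∣.*-monoʳ-∣ P $ p^-gauss α x′ y P∤y $ ℤ∣.*-cancelˡ-∣ P $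
      subst₂ _∣ℤ_ (p^-suc α) (regroup x′ P y) d
    where
    regroup : ∀ x p y → x ℤ.* p ℤ.* y ≡ p ℤ.* (x ℤ.* y)
    regroup = solve-∀

  -- By absorption p^α divides k C(p^α, k). Were the binomial prime to `p`, then p^α would divide
  -- `k`, which is positive and smaller.
  P∣bin : ∀ α k → 0 < k → k < p ^ α → P ∣ℤ bin (p ^ α) k
  P∣bin α (suc k) _ k<q with P ℤ∣.∣? bin (p ^ α) (suc k)
  ... | yes d  = d
  ... | no P∤b = contradiction (ℕ∣.∣⇒≤ (ℤ∣.∣⇒∣ᵤ (p^-gauss α (+ suc k) _ P∤b (q∣ (p ^ α) refl)))) (ℕₚ.<⇒≱ k<q)
    where
    q∣ : ∀ q → q ≡ p ^ α → + q ∣ℤ + suc k ℤ.* bin q (suc k)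
    q∣ zero    eq = contradiction (subst (suc k <_) (sym eq) k<q) λ ()
    q∣ (suc q) eq = divides (bin q k) (trans (bin-absorb q k) (ℤₚ.*-comm (+ suc q) (bin q k)))

  -- This is (1 - E^b)^q ≡ 1 - E^(qb). Subtracting the constant `c` first makes the term k = q
  -- vanish, so the sign (-1)^q never enters; the terms in between are divisible by `p`.
  frobenius : ∀ α q → q ≡ p ^ α → ∀ b φ x → ∇ b q φ x ≈ φ x ℤ.- φ (x + q * b)
  frobenius α zero eq b φ x = contradiction (subst (0 <_) (sym eq) (ℕₚ.m^n>0 p α)) λ ()
  frobenius α q@(suc q-1) eq b φ x = mod (subst₂ (λ u v → P ∣ℤ u ℤ.- v)
    (trans (sym (∇-expand b q _ x (suc q) (ℕₚ.n<1+n q))) (∇-subtract-const b q-1 c φ x))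
    head
    (∑-closed-except (P ∣ℤ_) (divides 0ℤ refl) ℤ∣.∣m∣n⇒∣m+n (suc q) 0 t (s≤s z≤n) others))
    where
    c = φ (x + q * b)
    t : ℕ → ℤ
    t k = sgn k ℤ.* bin q k ℤ.* (φ (x + k * b) ℤ.- c)
    head : t 0 ≡ φ x ℤ.- c
    head = trans (cong₂ (λ u v → 1ℤ ℤ.* u ℤ.* (φ v ℤ.- c)) (bin-n-0 q) (ℕₚ.+-identityʳ x)) (ℤₚ.*-identityˡ _)
    others : ∀ k → k < suc q → k ≢ 0 → P ∣ℤ t k
    others k (s≤s k≤q) k≢0 with k ℕ.≟ q
    ... | yes refl = divides 0ℤ (trans (*-congˡ (sgn k ℤ.* bin q k) (ℤₚ.+-inverseʳ c)) (ℤₚ.*-zeroʳ (sgn k ℤ.* bin q k)))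
    ... | no k≢q = ℤ∣.∣m⇒∣m*n _ (ℤ∣.∣n⇒∣m*n (sgn k)
      (subst (λ z → P ∣ℤ bin z k) (sym eq) (P∣bin α k (ℕₚ.n≢0⇒n>0 k≢0) (subst (k <_) eq (ℕₚ.≤∧≢⇒< k≤q k≢q)))))

  -- The sequence of powers of `y` is an eigenvector of the shift with eigenvalue `y`.
  ∇-geometric : ∀ y n x → ∇ 1 n (y ℤ.^_) x ≡ (1ℤ ℤ.- y) ℤ.^ n ℤ.* y ℤ.^ x
  ∇-geometric y zero    x = sym (ℤₚ.*-identityˡ _)
  ∇-geometric y (suc n) x = begin
    ∇ 1 n (y ℤ.^_) x ℤ.- ∇ 1 n (y ℤ.^_) (x + 1)
      ≡⟨ cong₂ ℤ._-_ (∇-geometric y n x) (trans (∇-geometric y n (x + 1)) (*-congˡ e (cong (y ℤ.^_) (ℕₚ.+-comm x 1)))) ⟩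
    e ℤ.* y ℤ.^ x ℤ.- e ℤ.* (y ℤ.* y ℤ.^ x)
      ≡⟨ collect e y (y ℤ.^ x) ⟩
    (1ℤ ℤ.- y) ℤ.* e ℤ.* y ℤ.^ x ∎
    where
    e = (1ℤ ℤ.- y) ℤ.^ n
    collect : ∀ e y z → e ℤ.* z ℤ.- e ℤ.* (y ℤ.* z) ≡ (1ℤ ℤ.- y) ℤ.* e ℤ.* z
    collect = solve-∀

  sgn-even : ∀ n → sgn (2 * n) ≡ 1ℤ
  sgn-even n = trans (sym (ℤₚ.^-*-assoc -1ℤ 2 n)) (ℤₚ.^-zeroˡ n)

  -- An equality for odd `p`. An even prime is 2, and 1 ≡ -1 modulo 2.
  sgn-p : sgn p ≈ -1ℤ
  sgn-p with p ℕ/.% 2 | ℕ/.m≡m%n+[m/n]*n p 2 | ℕ/.m%n<n p 2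
  ... | 0 | p≡ | _ with prime⇒irreducible p-prime (ℕ∣.divides (p ℕ/./ 2) p≡)
  ...   | inj₂ 2≡p = ≈-trans
    (≈-reflexive (trans (cong sgn (trans p≡ (ℕₚ.*-comm (p ℕ/./ 2) 2))) (sgn-even (p ℕ/./ 2))))
    (mod (divides 1ℤ (trans (cong +_ 2≡p) (sym (ℤₚ.*-identityˡ P)))))
  sgn-p | 1 | p≡ | _ = ≈-reflexive
    (trans (cong sgn (trans p≡ (cong suc (ℕₚ.*-comm (p ℕ/./ 2) 2)))) (*-congˡ -1ℤ (sgn-even (p ℕ/./ 2))))
  sgn-p | suc (suc _) | _ | s≤s (s≤s ())

  neg-^ : ∀ y n → (ℤ.- y) ℤ.^ n ≡ sgn n ℤ.* y ℤ.^ n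
  neg-^ y zero    = refl
  neg-^ y (suc n) = trans (*-congˡ (ℤ.- y) (neg-^ y n)) (regroup y (sgn n) (y ℤ.^ n))
    where
    regroup : ∀ y s z → (ℤ.- y) ℤ.* (s ℤ.* z) ≡ -1ℤ ℤ.* s ℤ.* (y ℤ.* z)
    regroup = solve-∀

  -- This is `frobenius` for the powers of `- y`, evaluated at 0.
  [1+y]^p : ∀ y → (1ℤ ℤ.+ y) ℤ.^ p ≈ 1ℤ ℤ.+ y ℤ.^ p
  [1+y]^p y = ≈-trans (≈-reflexive (begin
      (1ℤ ℤ.+ y) ℤ.^ p                        ≡⟨ cong (λ z → (1ℤ ℤ.+ z) ℤ.^ p) (ℤₚ.neg-involutive y) ⟨
      (1ℤ ℤ.- (ℤ.- y)) ℤ.^ p                  ≡⟨ ℤₚ.*-identityʳ _ ⟨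
      (1ℤ ℤ.- (ℤ.- y)) ℤ.^ p ℤ.* 1ℤ           ≡⟨ ∇-geometric (ℤ.- y) p 0 ⟨
      ∇ 1 p ((ℤ.- y) ℤ.^_) 0                  ∎))
    (≈-trans (frobenius 1 p (sym (ℕₚ.*-identityʳ p)) 1 ((ℤ.- y) ℤ.^_) 0)
    (≈-trans (≈-reflexive (cong (λ z → 1ℤ ℤ.- z) (trans (cong ((ℤ.- y) ℤ.^_) (ℕₚ.*-identityʳ p)) (neg-^ y p))))
    (≈-trans (≈-- (≈-refl {1ℤ}) (≈-* sgn-p (≈-refl {y ℤ.^ p}))) (≈-reflexive (simplify (y ℤ.^ p))))))
    where
    simplify : ∀ z → 1ℤ ℤ.- -1ℤ ℤ.* z ≡ 1ℤ ℤ.+ z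
    simplify = solve-∀

  0^ : ∀ n → 0 < n → 0ℤ ℤ.^ n ≡ 0ℤ
  0^ (suc n) _ = refl

  fermat : ∀ y → y ℤ.^ p ≈ y
  fermat (+ zero)  = ≈-reflexive (0^ p (ℕₚ.<-trans (s≤s z≤n) 1<p))
  fermat (+ suc n) = ≈-trans ([1+y]^p (+ n)) (≈-+ (≈-refl {1ℤ}) (fermat (+ n)))
  -- The congruence (1 + y)^p ≡ 1 + y^p also carries the claim downwards, from `1 + y` to `y`, and
  -- so reaches the negative integers.
  fermat ℤ.-[1+ n ] = descend ℤ.-[1+ n ] (fermat-1+ n)
    where
    descend : ∀ y → (1ℤ ℤ.+ y) ℤ.^ p ≈ 1ℤ ℤ.+ y → y ℤ.^ p ≈ y
    descend y e = subst₂ _≈_ (cancel (y ℤ.^ p)) (cancel y)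
      (≈-- (≈-trans (≈-sym ([1+y]^p y)) e) (≈-refl {1ℤ}))
      where
      cancel : ∀ z → 1ℤ ℤ.+ z ℤ.- 1ℤ ≡ z
      cancel = solve-∀
    fermat-1+ : ∀ n → (1ℤ ℤ.+ ℤ.-[1+ n ]) ℤ.^ p ≈ 1ℤ ℤ.+ ℤ.-[1+ n ]
    fermat-1+ zero    = fermat 0ℤ
    fermat-1+ (suc n) = fermat ℤ.-[1+ n ]

  -- Valuation of factorials and units congruent to 1

  Loc-mono : ∀ {A B x} → A ∣ℤ B → Loc B x → Loc A x
  Loc-mono {x = x} A∣B = Loc-trans {x = x} (∣⇒Loc A∣B)

  -- Among the factors of (c + kp)! the multiples of `p` contribute p^k k!, and all others are prime
  -- to `p`.
  !-unit-part : ∀ k c → c < p → ∃ λ u → (¬ P ∣ℤ u) × + ((c + k * p) !) ≡ u ℤ.* (P ℤ.^ k ℤ.* + (k !))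
  !-unit-part zero    zero    _ = 1ℤ , P∤1 , refl
  !-unit-part (suc k) zero    _ =
    let u , P∤u , eq = !-unit-part k (p ∸ 1) (subst ((p ∸ 1) <_) (sym p≡1+[p∸1]) (ℕₚ.n<1+n (p ∸ 1)))
    in u , P∤u , (begin
      + ((p + k * p) !)
        ≡⟨ cong (λ z → + ((z + k * p) !)) p≡1+[p∸1] ⟩
      + (suc ((p ∸ 1) + k * p) * ((p ∸ 1) + k * p) !)
        ≡⟨ ℤₚ.pos-* (suc ((p ∸ 1) + k * p)) (((p ∸ 1) + k * p) !) ⟩
      + suc ((p ∸ 1) + k * p) ℤ.* + (((p ∸ 1) + k * p) !)
        ≡⟨ cong₂ ℤ._*_ (trans (cong (λ z → + (z + k * p)) (sym p≡1+[p∸1])) (ℤₚ.pos-* (suc k) p)) eq ⟩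
      + suc k ℤ.* P ℤ.* (u ℤ.* (P ℤ.^ k ℤ.* + (k !)))
        ≡⟨ regroup (+ suc k) P u (P ℤ.^ k) (+ (k !)) ⟩
      u ℤ.* (P ℤ.* P ℤ.^ k ℤ.* (+ suc k ℤ.* + (k !)))
        ≡⟨ cong (λ z → u ℤ.* (P ℤ.* P ℤ.^ k ℤ.* z)) (ℤₚ.pos-* (suc k) (k !)) ⟨
      u ℤ.* (P ℤ.^ suc k ℤ.* + (suc k !)) ∎)
    where
    regroup : ∀ s p u e f → s ℤ.* p ℤ.* (u ℤ.* (e ℤ.* f)) ≡ u ℤ.* (p ℤ.* e ℤ.* (s ℤ.* f))
    regroup = solve-∀
  !-unit-part k (suc c) 1+c<p =
    let u , P∤u , eq = !-unit-part k c (ℕₚ.<-trans (ℕₚ.n<1+n c) 1+c<p)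
    in + suc (c + k * p) ℤ.* u , P∤-* (λ d → P∤+multiple (+ k) (P∤-small (s≤s z≤n) 1+c<p)
         (subst (P ∣ℤ_) (trans (pos-+-* (suc c) k p) (+-congˡ (+ suc c) (ℤₚ.*-comm (+ k) P))) d)) P∤u ,
       trans (ℤₚ.pos-* (suc (c + k * p)) ((c + k * p) !)) (trans (*-congˡ (+ suc (c + k * p)) eq)
         (sym (ℤₚ.*-assoc (+ suc (c + k * p)) u (P ℤ.^ k ℤ.* + (k !)))))

  P^-mono : ∀ {m n} → m ≤ n → P ℤ.^ m ∣ℤ P ℤ.^ n
  P^-mono {m} {n} m≤n = divides (P ℤ.^ (n ∸ m)) (trans (cong (P ℤ.^_) (sym (ℕₚ.m∸n+n≡m m≤n))) (ℤₚ.^-distribˡ-+-* P (n ∸ m) m))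

  -- vₚ(m!) < m
  Loc-P!-P^ : ∀ N m → m < N → 0 < m → Loc (P ℤ.* + (m !)) (P ℤ.^ m)
  Loc-P!-P^ (suc N) m (s≤s m≤N) 0<m = subst (λ m → Loc (P ℤ.* + (m !)) (P ℤ.^ m)) (sym m≡)
    -- `N` bounds the recursion, which passes from `m = c + k * p` to the smaller `k`.
    (go k c<p (subst (0 <_) m≡ 0<m) (subst (_≤ N) m≡ m≤N))
    where
    c = m ℕ/.% p
    k = m ℕ/./ p
    m≡ : m ≡ c + k * p
    m≡ = ℕ/.m≡m%n+[m/n]*n m p
    c<p : c < p
    c<p = ℕ/.m%n<n m p
    go : ∀ k {c} → c < p → 0 < c + k * p → c + k * p ≤ N → Loc (P ℤ.* + ((c + k * p) !)) (P ℤ.^ (c + k * p))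
    go zero {zero} _ () _
    -- Here `m < p`, so m! is prime to `p`, and a single factor `p` divides p^m because `m` is
    -- positive.
    go zero {suc c} c<p _ _ =
      let u , P∤u , eq = !-unit-part 0 (suc c) c<p in
      u , P∤u , divides (P ℤ.^ (c + 0)) (trans (regroup u P (P ℤ.^ (c + 0))) (sym (cong (λ z → P ℤ.^ (c + 0) ℤ.* (P ℤ.* z)) eq)))
      where
      regroup : ∀ u p e → u ℤ.* (p ℤ.* e) ≡ e ℤ.* (p ℤ.* (u ℤ.* 1ℤ))
      regroup = solve-∀
    -- Up to units m! is p^k k!, and p k! divides p^k by recursion. Hence p m! divides p^(2k), and
    -- 2k ≤ kp ≤ m.
    go k′@(suc k-1) {c} c<p _ ≤N =
      let u , P∤u , eq = !-unit-part k′ c c<p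
          k<N = ℕₚ.<-≤-trans (ℕₚ.<-≤-trans (ℕₚ.m<m*n k′ p 1<p) (ℕₚ.m≤n+m (k′ * p) c)) ≤N
          w , P∤w , d = Loc-P!-P^ N k′ k<N (s≤s z≤n)
          scaled = ℤ∣.*-monoʳ-∣ (u ℤ.* P ℤ.^ k′) d
          k′+k′≤ = ℕₚ.≤-trans (subst (_≤ k′ * p) (trans (ℕₚ.*-comm k′ 2) (cong (λ z → k′ + z) (ℕₚ.+-identityʳ k′))) (ℕₚ.*-monoʳ-≤ k′ 1<p)) (ℕₚ.m≤n+m (k′ * p) c)
      in u ℤ.* w , P∤-* P∤u P∤w , ℤ∣.∣-trans
        (subst₂ _∣ℤ_
          (trans (regroup u (P ℤ.^ k′) P (+ (k′ !))) (*-congˡ P (sym eq)))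
          (trans (regroup′ u (P ℤ.^ k′) w) (*-congˡ (u ℤ.* w) (sym (ℤₚ.^-distribˡ-+-* P k′ k′)))) scaled)
        (ℤ∣.*-monoʳ-∣ (u ℤ.* w) (P^-mono k′+k′≤))
      where
      regroup : ∀ u e p f → u ℤ.* e ℤ.* (p ℤ.* f) ≡ p ℤ.* (u ℤ.* (e ℤ.* f))
      regroup = solve-∀
      regroup′ : ∀ u e w → u ℤ.* e ℤ.* (w ℤ.* e) ≡ u ℤ.* w ℤ.* (e ℤ.* e)
      regroup′ = solve-∀

  -- x ∼ y says x ∈ y (1 + p ℤ₍ₚ₎).
  infix 4 _∼_
  _∼_ : ℤ → ℤ → Set
  x ∼ y = ∃ λ u → ∃ λ v → (¬ P ∣ℤ u) × u ≈ v × u ℤ.* x ≡ v ℤ.* y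

  P∤-≈ : ∀ {u v} → ¬ P ∣ℤ u → u ≈ v → ¬ P ∣ℤ v
  P∤-≈ P∤u u≈v P∣v = P∤u (≈0⇒∣ (≈-trans u≈v (∣⇒≈0 P∣v)))

  ∼-reflexive : ∀ {x y} → x ≡ y → x ∼ y
  ∼-reflexive eq = 1ℤ , 1ℤ , P∤1 , ≈-refl , *-congˡ 1ℤ eq

  ∼-sym : ∀ {x y} → x ∼ y → y ∼ x
  ∼-sym (u , v , P∤u , u≈v , eq) = v , u , P∤-≈ P∤u u≈v , ≈-sym u≈v , sym eq

  *-middle : ∀ a b x y → a ℤ.* b ℤ.* (x ℤ.* y) ≡ a ℤ.* x ℤ.* (b ℤ.* y)
  *-middle = solve-∀

  ∼-* : ∀ {x y x′ y′} → x ∼ y → x′ ∼ y′ → x ℤ.* x′ ∼ y ℤ.* y′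
  ∼-* {x} {y} {x′} {y′} (u , v , P∤u , u≈v , eq) (u′ , v′ , P∤u′ , u′≈v′ , eq′) =
    u ℤ.* u′ , v ℤ.* v′ , P∤-* P∤u P∤u′ , ≈-* u≈v u′≈v′ ,
    trans (*-middle u u′ x x′) (trans (cong₂ ℤ._*_ eq eq′) (sym (*-middle v v′ y y′)))

  ∼-cancel : ∀ {x y} c .{{_ : ℤ.NonZero c}} → c ℤ.* x ∼ c ℤ.* y → x ∼ y
  ∼-cancel {x} {y} c (u , v , P∤u , u≈v , eq) = u , v , P∤u , u≈v ,
    ℤₚ.*-cancelˡ-≡ c _ _ (trans (x∙yz≡y∙xz c u x) (trans eq (x∙yz≡y∙xz v c y)))

  ∼-trans : ∀ {x y z} → x ∼ y → y ∼ z → x ∼ z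
  ∼-trans {x} {y} {z} (u , v , P∤u , u≈v , eq) (u′ , v′ , P∤u′ , u′≈v′ , eq′) =
    u′ ℤ.* u , v ℤ.* v′ , P∤-* P∤u′ P∤u , ≈-trans (≈-* u′≈v′ u≈v) (≈-reflexive (ℤₚ.*-comm v′ v)) , (begin
      u′ ℤ.* u ℤ.* x       ≡⟨ ℤₚ.*-assoc u′ u x ⟩
      u′ ℤ.* (u ℤ.* x)     ≡⟨ *-congˡ u′ eq ⟩
      u′ ℤ.* (v ℤ.* y)     ≡⟨ x∙yz≡y∙xz u′ v y ⟩
      v ℤ.* (u′ ℤ.* y)     ≡⟨ *-congˡ v eq′ ⟩
      v ℤ.* (v′ ℤ.* z)     ≡⟨ ℤₚ.*-assoc v v′ z ⟨
      v ℤ.* v′ ℤ.* z       ∎)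

  ∼⇒Loc : ∀ {x y} → x ∼ y → Loc (P ℤ.* y) (P ℤ.* x)
  ∼⇒Loc {x} {y} (u , v , P∤u , u≈v , eq) = u , P∤u ,
    divides v (trans (x∙yz≡y∙xz u P x) (trans (*-congˡ P eq) (x∙yz≡y∙xz P v y)))

  ∼⇒Loc-- : ∀ {x y} → x ∼ y → Loc (P ℤ.* y) (x ℤ.- y)
  ∼⇒Loc-- {x} {y} (u , v , P∤u , u≈v , eq) =
    let divides k v-u≡ = unmod (≈-sym u≈v) in u , P∤u , divides k (begin
      u ℤ.* (x ℤ.- y)            ≡⟨ distrib u x y ⟩
      u ℤ.* x ℤ.- u ℤ.* y        ≡⟨ cong (λ z → z ℤ.- u ℤ.* y) eq ⟩
      v ℤ.* y ℤ.- u ℤ.* y        ≡⟨ undistrib v u y ⟩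
      (v ℤ.- u) ℤ.* y            ≡⟨ cong (λ z → z ℤ.* y) v-u≡ ⟩
      k ℤ.* P ℤ.* y              ≡⟨ ℤₚ.*-assoc k P y ⟩
      k ℤ.* (P ℤ.* y)            ∎)
    where
    distrib : ∀ u x y → u ℤ.* (x ℤ.- y) ≡ u ℤ.* x ℤ.- u ℤ.* y
    distrib = solve-∀
    undistrib : ∀ v u y → v ℤ.* y ℤ.- u ℤ.* y ≡ (v ℤ.- u) ℤ.* y
    undistrib = solve-∀

  -- Signs and Newton coefficients modulo p

  sgn-p* : ∀ k → sgn (p * k) ≈ sgn k
  sgn-p* k = ≈-trans (≈-reflexive (sym (ℤₚ.^-*-assoc -1ℤ p k))) (≈-^ k sgn-p)

  sgn-p^* : ∀ α k → sgn (p ^ α * k) ≈ sgn k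
  sgn-p^* zero    k = ≈-reflexive (cong sgn (ℕₚ.*-identityˡ k))
  sgn-p^* (suc α) k = ≈-trans (≈-reflexive (cong sgn (ℕₚ.*-assoc p (p ^ α) k)))
    (≈-trans (sgn-p* (p ^ α * k)) (sgn-p^* α k))

  sgn-[p-1]* : ∀ k → sgn ((p ∸ 1) * k) ≈ 1ℤ
  sgn-[p-1]* k = ≈-trans (≈-reflexive (sym (ℤₚ.^-*-assoc -1ℤ (p ∸ 1) k)))
    (≈-trans (≈-^ k sgn-[p-1]) (≈-reflexive (ℤₚ.^-zeroˡ k)))
    where
    neg-neg : ∀ s → -1ℤ ℤ.* (-1ℤ ℤ.* s) ≡ s
    neg-neg = solve-∀
    sgn-[p-1] : sgn (p ∸ 1) ≈ 1ℤ
    sgn-[p-1] = subst₂ _≈_ (neg-neg (sgn (p ∸ 1))) refl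
      (≈-* (≈-refl {x = -1ℤ}) (subst (λ z → sgn z ≈ -1ℤ) p≡1+[p∸1] sgn-p))

  -- Up to sign the factors are `k - i` with `i < j ≤ k < p`, hence between 1 and p - 1.
  P∤∏-diff : ∀ b k j → k < p → j ≤ k → ¬ P ∣ℤ ∏-diff (λ i → b ℤ.- + i) (b ℤ.- + k) j
  P∤∏-diff b k zero    k<p _   = P∤1
  P∤∏-diff b k (suc j) k<p j<k = P∤-* (P∤∏-diff b k j k<p (ℕₚ.<⇒≤ j<k)) λ d →
    P∤-small (ℕₚ.m<n⇒0<n∸m j<k) (ℕₚ.≤-<-trans (ℕₚ.m∸n≤m k j) k<p)
      (subst (P ∣ℤ_) (trans (flip b (+ k) (+ j)) (trans (ℤₚ.m-n≡m⊖n k j) (ℤₚ.⊖-≥ (ℕₚ.<⇒≤ j<k)))) (ℤ∣.∣m⇒∣-m d))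
    where
    flip : ∀ b k j → ℤ.- ((b ℤ.- k) ℤ.- (b ℤ.- j)) ≡ k ℤ.- j
    flip = solve-∀

  -- Over 𝔽ₚ the nodes b, b-1, …, b-p+1 are all the residues, and y ^ p - y is the monic
  -- polynomial of degree p vanishing at them.
  newton-p : ∀ b j → j < p → newton (λ i → b ℤ.- + i) p j ≈ newton (λ i → b ℤ.- + i) 1 j
  newton-p b j j<p = below (suc j) j (ℕₚ.n<1+n j) j<p
    where
    x : ℕ → ℤ
    x i = b ℤ.- + i
    D : ℕ → ℤ
    D i = newton x p i ℤ.- newton x 1 i
    ∑D : ∀ k → ∑ (suc p) (λ i → D i ℤ.* ∏-diff x (x k) i) ≡ x k ℤ.^ p ℤ.- x k
    ∑D k = trans (newton-eval-- x (x k) p 1 (suc p) (ℕₚ.n<1+n p) (ℕₚ.m<n⇒m<1+n 1<p))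
      (cong (λ z → x k ℤ.^ p ℤ.- z) (ℤₚ.^-identityʳ (x k)))
    -- Strong induction on `j`, bounded by `N`. At `y = x k` the terms beyond `k` vanish, those
    -- before it are divisible by `p` by induction, and the whole sum is so by Fermat. What is left
    -- is `D k` times an integer prime to `p`.
    below : ∀ N j → j < N → j < p → newton x p j ≈ newton x 1 j
    below (suc N) k (s≤s k≤N) k<p =
      [ mod , (λ P∣Π → contradiction P∣Π (P∤∏-diff b k k k<p ℕₚ.≤-refl)) ]′
        (P-euclid (D k) (∏-diff x (x k) k) P∣DΠ)
      where
      P∣DΠ : P ∣ℤ D k ℤ.* ∏-diff x (x k) k
      P∣DΠ = ℤ∣.∣m+n∣m⇒∣n {m = ∑ (suc p) f ℤ.- f k} {n = f k} 
        (subst (P ∣ℤ_) (trans (sym (∑D k)) (add-back (∑ (suc p) f) (f k))) (unmod (fermat (x k))))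
        (∑-closed-except (P ∣ℤ_) (divides 0ℤ refl) ℤ∣.∣m∣n⇒∣m+n (suc p) k f (ℕₚ.m<n⇒m<1+n k<p) others)
        where
        f : ℕ → ℤ
        f i = D i ℤ.* ∏-diff x (x k) i
        add-back : ∀ s t → s ≡ (s ℤ.- t) ℤ.+ t
        add-back = solve-∀
        others : ∀ i → i < suc p → i ≢ k → P ∣ℤ f i
        others i _ i≢k with ℕₚ.<-cmp i k
        ... | tri< i<k _ _ = ℤ∣.∣m⇒∣m*n _ (unmod (below N i (ℕₚ.<-≤-trans i<k k≤N) (ℕₚ.<-trans i<k k<p)))
        ... | tri≈ _ i≡k _ = contradiction i≡k i≢k
        ... | tri> _ _ k<i = divides 0ℤ (trans (*-congˡ (D i) (∏-diff-node x k<i)) (ℤₚ.*-zeroʳ (D i)))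

  ≈-∑ : ∀ n {f g : ℕ → ℤ} → (∀ j → j < n → f j ≈ g j) → ∑ n f ≈ ∑ n g
  ≈-∑ zero    e = ≈-refl
  ≈-∑ (suc n) e = ≈-+ (e 0 (s≤s z≤n)) (≈-∑ n λ j j<n → e (suc j) (s≤s j<n))

  -- If the coefficients of y^n and y^n′ agree modulo `p` below degree `n`, the two expansions
  -- differ only in the top term, whose coefficient is 1.
  newton-expand-≈ : ∀ x (F : ℕ → ℕ → ℤ) → (∀ j l → F j (suc l) ≡ x j ℤ.* F j l ℤ.+ F (suc j) l) →
    ∀ n n′ l → n′ < n → (∀ j → j < n → newton x n j ≈ newton x n′ j) →
    F 0 (n + l) ≈ F 0 (n′ + l) ℤ.+ F n l
  newton-expand-≈ x F rec n n′ l n′<n e = ≈-trans (≈-reflexive expand-n)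
    (≈-trans (≈-+ (≈-∑ n λ j j<n → ≈-* (e j j<n) (≈-refl {F j l})) (≈-refl {F n l}))
    (≈-reflexive (cong (λ z → z ℤ.+ F n l) (sym (newton-expand x F rec n′ l n n′<n)))))
    where
    expand-n : F 0 (n + l) ≡ ∑ n (λ j → newton x n j ℤ.* F j l) ℤ.+ F n l
    expand-n = trans (newton-expand x F rec n l (suc n) (ℕₚ.n<1+n n))
      (trans (∑-last n (λ j → newton x n j ℤ.* F j l))
        (+-congˡ (∑ n (λ j → newton x n j ℤ.* F j l))
          (trans (cong (λ z → z ℤ.* F n l) (newton-n-n x n)) (ℤₚ.*-identityˡ (F n l)))))

  -- Periodicity of the coefficients h(l,m) modulo p

  module Periodicity (a : ℤ) where

    h : ℕ → ℕ → ℤ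
    h = newton (λ j → + j ℤ.- a)

    -- back m j l is h l (m - j), and 0 if j > m.
    back : ℕ → ℕ → ℕ → ℤ
    back m       zero    l = h l m
    back zero    (suc j) l = 0ℤ
    back (suc m) (suc j) l = back m j l

    -- The recursion of `newton` read downwards. It makes `back m` a sequence to which
    -- `newton-expand` applies, with the descending nodes `m - a`, `m - a - 1`, ... required by
    -- `newton-p`.
    back-rec : ∀ m j l → back m j (suc l) ≡ ((+ m ℤ.- a) ℤ.- + j) ℤ.* back m j l ℤ.+ back m (suc j) l
    back-rec zero    zero    l = trans (cong (λ z → z ℤ.* h l 0) (sym (ℤₚ.+-identityʳ (0ℤ ℤ.- a)))) (sym (ℤₚ.+-identityʳ _))
    back-rec zero    (suc j) l = sym (trans (ℤₚ.+-identityʳ _) (ℤₚ.*-zeroʳ ((0ℤ ℤ.- a) ℤ.- + suc j)))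
    back-rec (suc m) zero    l = cong (λ z → z ℤ.* h l (suc m) ℤ.+ h l m) (sym (ℤₚ.+-identityʳ (+ suc m ℤ.- a)))
    back-rec (suc m) (suc j) l = trans (back-rec m j l) (cong (λ z → z ℤ.* back m j l ℤ.+ back m (suc j) l) (shift (+ m) a (+ j)))
      where
      shift : ∀ m a j → (m ℤ.- a) ℤ.- j ≡ ((1ℤ ℤ.+ m) ℤ.- a) ℤ.- (1ℤ ℤ.+ j)
      shift = solve-∀

    back>≡0 : ∀ m j l → m < j → back m j l ≡ 0ℤ
    back>≡0 zero    (suc j) l _ = refl
    back>≡0 (suc m) (suc j) l (s≤s m<j) = back>≡0 m j l m<j

    back-m-m : ∀ m l → back m m l ≡ (0ℤ ℤ.- a) ℤ.^ l
    back-m-m zero    l = newton-n-0 (λ j → + j ℤ.- a) l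
    back-m-m (suc m) l = back-m-m m l

    h-p : ∀ m l → h (p + l) m ≈ h (suc l) m ℤ.+ back m p l
    h-p m l = newton-expand-≈ _ (back m) (back-rec m) p 1 l 1<p (newton-p (+ m ℤ.- a))

    back-p : ∀ m j l → back m j (p + l) ≈ back m j (suc l) ℤ.+ back m (j + p) l
    back-p m       zero    l = h-p m l
    back-p zero    (suc j) l = ≈-refl
    back-p (suc m) (suc j) l = back-p m j l

    -- With b = p - 1 this evaluates (1 - E^b)^k E^k = (E - E^p)^k. By `back-p` each factor E^p - E
    -- moves `p` places back, and the opposite sign accounts for (-1)^k.
    ∇-back : ∀ b → p ≡ suc b → ∀ k m j l → ∇ b k (back m j) (l + k) ≈ sgn k ℤ.* back m (j + k * p) l
    ∇-back b p≡ zero    m j l = ≈-reflexive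
      (trans (cong₂ (back m) (sym (ℕₚ.+-identityʳ j)) (ℕₚ.+-identityʳ l)) (sym (ℤₚ.*-identityˡ _)))
    ∇-back b p≡ (suc k) m j l =
      ≈-trans (≈-reflexive (cong₂ (λ u v → ∇ b k (back m j) u ℤ.- ∇ b k (back m j) v) (ℕₚ.+-suc l k) l+1+k+b))
      (≈-trans (≈-- (∇-back b p≡ k m j (suc l)) (∇-back b p≡ k m j (p + l)))
      (≈-trans (≈-- (≈-refl {s ℤ.* B (suc l)}) (≈-* (≈-refl {s}) (back-p m (j + k * p) l)))
      (≈-reflexive (trans (cancel s (B (suc l)) _) (cong (λ z → -1ℤ ℤ.* s ℤ.* back m z l)
        (trans (ℕₚ.+-assoc j (k * p) p) (cong (λ z → j + z) (ℕₚ.+-comm (k * p) p))))))))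
      where
      s = sgn k
      B = back m (j + k * p)
      cancel : ∀ s x y → s ℤ.* x ℤ.- s ℤ.* (x ℤ.+ y) ≡ -1ℤ ℤ.* s ℤ.* y
      cancel = solve-∀
      l+1+k+b : l + suc k + b ≡ p + l + k
      l+1+k+b = begin
        l + suc k + b      ≡⟨ ℕₚ.+-comm (l + suc k) b ⟩
        b + (l + suc k)    ≡⟨ cong (λ z → b + z) (ℕₚ.+-suc l k) ⟩
        b + suc (l + k)    ≡⟨ ℕₚ.+-suc b (l + k) ⟩
        suc b + (l + k)    ≡⟨ ℕₚ.+-assoc (suc b) l k ⟨
        suc b + l + k      ≡⟨ cong (λ z → z + l + k) p≡ ⟨
        p + l + k          ∎

    -- Two evaluations of (1 - E^(p-1))^q for q = p^e: `frobenius` gives 1 - E^((p-1)q), while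
    -- `∇-back` gives a multiple of the term assumed to vanish.
    h-periodic : ∀ e m l → back m (p ^ suc e) l ≈ 0ℤ → h ((l + p ^ e) + (p ∸ 1) * p ^ e) m ≈ h (l + p ^ e) m
    h-periodic e m l z = ≈-sym (subst₂ _≈_ (cancel _ _) (ℤₚ.+-identityˡ _) (≈-+ (≈-trans
        (≈-sym (frobenius e q refl (p ∸ 1) (λ y → h y m) (l + q)))
        (≈-trans (∇-back (p ∸ 1) p≡1+[p∸1] q m 0 l)
        (≈-trans (≈-* (≈-refl {sgn q}) (subst (λ z → back m z l ≈ 0ℤ) (ℕₚ.*-comm p q) z)) (≈-reflexive (ℤₚ.*-zeroʳ (sgn q))))))
        (≈-reflexive {h (l + q + q * (p ∸ 1)) m} (cong (λ z → h (l + q + z) m) (ℕₚ.*-comm q (p ∸ 1))))))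
      where
      q = p ^ e
      cancel : ∀ x y → x ℤ.- y ℤ.+ y ≡ x
      cancel = solve-∀

    h≈1 : ∀ m c → (∀ N → m ≤ N → h (N + c) m ≈ h N m) → ∀ t → h (m + t * c) m ≈ 1ℤ
    h≈1 m c per zero    = ≈-reflexive (trans (cong (λ z → h z m) (ℕₚ.+-identityʳ m)) (newton-n-n _ m))
    h≈1 m c per (suc t) = ≈-trans
      (≈-reflexive (cong (λ z → h z m) (trans (cong (λ z → m + z) (ℕₚ.+-comm c (t * c))) (sym (ℕₚ.+-assoc m (t * c) c)))))
      (≈-trans (per (m + t * c) (ℕₚ.m≤m+n m (t * c))) (h≈1 m c per t))

    -- As `m < p ^ suc e`, going back p^(e+1) places leaves the range of indices, so the hypothesis
    -- of `h-periodic` is immediate.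
    h≈1-generic : ∀ e m t → p ^ e ≤ m → m < p ^ suc e → h (m + t * ((p ∸ 1) * p ^ e)) m ≈ 1ℤ
    h≈1-generic e m t q≤m m<pq = h≈1 m _ (λ N m≤N →
      subst (λ z → h (z + (p ∸ 1) * p ^ e) m ≈ h z m) (ℕₚ.m∸n+n≡m (ℕₚ.≤-trans q≤m m≤N))
        (h-periodic e m (N ∸ p ^ e) (≈-reflexive (back>≡0 m (p ^ suc e) _ m<pq)))) t

    -- Now the logarithm of `m` is `suc e`, yet the exponent `e` suffices: going back `m` places
    -- ends at h(l,0) = (-a)^l. This is 0 modulo `p` because `l = N ∸ p ^ e` is positive.
    h≈1-δ : ∀ e m t → p ^ suc e ≡ m → P ∣ℤ a → h (m + t * ((p ∸ 1) * p ^ e)) m ≈ 1ℤ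
    h≈1-δ e m t refl P∣a = h≈1 m _ (λ N m≤N →
      let p^e<N = ℕₚ.<-≤-trans (ℕₚ.^-monoʳ-< p 1<p (ℕₚ.n<1+n e)) m≤N in
      subst (λ z → h (z + (p ∸ 1) * p ^ e) m ≈ h z m) (ℕₚ.m∸n+n≡m (ℕₚ.<⇒≤ p^e<N))
        (h-periodic e m (N ∸ p ^ e) (≈-trans (≈-reflexive (back-m-m m (N ∸ p ^ e)))
          (≈-trans (≈-^ (N ∸ p ^ e) 0-a≈0) (≈-reflexive (0^ (N ∸ p ^ e) (ℕₚ.m<n⇒0<n∸m p^e<N))))))) t
      where
      0-a≈0 : 0ℤ ℤ.- a ≈ 0ℤ
      0-a≈0 = ≈-trans (≈-- (≈-refl {0ℤ}) (∣⇒≈0 P∣a)) ≈-refl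

  -- Divisibility of the sums T below the top index

  module Sections (α : ℕ) where

    q : ℕ
    q = p ^ α

    instance
      q≢0 : ℕ.NonZero q
      q≢0 = ℕₚ.m^n≢0 p α

    -- On a `q`-periodic sequence ∇^q ≡ 1 - E^q = 0 modulo `p`. The quotient `ψ` by `p` is again
    -- `q`-periodic, so the argument can be repeated `m` times.
    P^∣∇-periodic : ∀ m φ → (∀ x → φ (x + q) ≡ φ x) → ∀ x → P ℤ.^ m ∣ℤ ∇ 1 (m * q) φ x
    P^∣∇-periodic zero    φ per x = divides (φ x) (sym (ℤₚ.*-identityʳ _))
    P^∣∇-periodic (suc m) φ per x = subst (P ℤ.^ suc m ∣ℤ_)
      (begin
        P ℤ.* ∇ 1 (m * q) ψ x                    ≡⟨ ∇-scale 1 (m * q) P ψ x ⟨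
        ∇ 1 (m * q) (λ y → P ℤ.* ψ y) x          ≡⟨ ∇-cong 1 (m * q) (λ y → sym (ψ-eq y)) x ⟩
        ∇ 1 (m * q) (∇ 1 q φ) x                  ≡⟨ ∇-+ 1 (m * q) q φ x ⟨
        ∇ 1 (m * q + q) φ x                      ≡⟨ cong (λ z → ∇ 1 z φ x) (ℕₚ.+-comm (m * q) q) ⟩
        ∇ 1 (suc m * q) φ x                      ∎)
      (ℤ∣.*-monoʳ-∣ P (P^∣∇-periodic m ψ ψ-per x))
      where
      P∣∇q : ∀ y → P ∣ℤ ∇ 1 q φ y
      P∣∇q y = ≈0⇒∣ (≈-trans (frobenius α q refl 1 φ y) (≈-reflexive
        (trans (cong (λ z → φ y ℤ.- z) (trans (cong (λ z → φ (y + z)) (ℕₚ.*-identityʳ q)) (per y))) (ℤₚ.+-inverseʳ (φ y)))))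
      ψ : ℕ → ℤ
      ψ y = ℤ∣.quotient (P∣∇q y)
      ψ-eq : ∀ y → ∇ 1 q φ y ≡ P ℤ.* ψ y
      ψ-eq y = trans (ℤ∣._∣_.equality (P∣∇q y)) (ℤₚ.*-comm (ψ y) P)
      ψ-per : ∀ y → ψ (y + q) ≡ ψ y
      ψ-per y = ℤₚ.*-cancelˡ-≡ P _ _ (begin
        P ℤ.* ψ (y + q)                ≡⟨ ψ-eq (y + q) ⟨
        ∇ 1 q φ (y + q)                ≡⟨ ∇-shift 1 q q φ y ⟨
        ∇ 1 q (λ z → φ (z + q)) y      ≡⟨ ∇-cong 1 q per y ⟩
        ∇ 1 q φ y                      ≡⟨ ψ-eq y ⟩
        P ℤ.* ψ y                      ∎)

    χ : ℕ → ℤ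
    χ k = if does (k ℕ/.% q ℕ.≟ 0) then 1ℤ else 0ℤ

    χ≡1 : ∀ k → k ℕ/.% q ≡ 0 → χ k ≡ 1ℤ
    χ≡1 k e = cong (λ b → if b then 1ℤ else 0ℤ) (dec-true (k ℕ/.% q ℕ.≟ 0) e)

    χ≡0 : ∀ k → k ℕ/.% q ≢ 0 → χ k ≡ 0ℤ
    χ≡0 k e = cong (λ b → if b then 1ℤ else 0ℤ) (dec-false (k ℕ/.% q ℕ.≟ 0) e)

    P^∣T-00 : ∀ m → P ℤ.^ m ∣ℤ T q (m * q) 0 m 0
    P^∣T-00 m = subst (P ℤ.^ m ∣ℤ_) (begin
      ∇ 1 (m * q) χ 0                ≡⟨ ∇-expand 1 (m * q) χ 0 (suc (m * q)) (ℕₚ.n<1+n (m * q)) ⟩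
      ∑ (suc (m * q)) f              ≡⟨ ∑-residue q 0 0 m f (ℕₚ.m^n>0 p α) (ℕₚ.m^n>0 p α) vanish ⟩
      ∑ (suc m) (λ i → f (i * q))    ≡⟨ ∑-cong (suc m) (λ i → *-congˡ (sgn (i * q) ℤ.* bin (m * q) (i * q))
                                          (χ≡1 (i * q * 1) (trans (cong (ℕ/._% q) (ℕₚ.*-identityʳ (i * q))) (ℕ/.m*n%n≡0 i q)))) ⟩
      T q (m * q) 0 m 0              ∎)
      (P^∣∇-periodic m χ (λ x → cong (λ z → if does (z ℕ.≟ 0) then 1ℤ else 0ℤ) (ℕ/.[m+n]%n≡m%n x q)) 0)
      where
      f : ℕ → ℤ
      f k = sgn k ℤ.* bin (m * q) k ℤ.* χ (k * 1)
      vanish : ∀ c i → c < q → c ≢ 0 → f (c + i * q) ≡ 0ℤ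
      vanish c i c<q c≢0 = trans (*-congˡ (sgn (c + i * q) ℤ.* bin (m * q) (c + i * q))
        (χ≡0 ((c + i * q) * 1) λ e → c≢0 (trans (sym (ℕ/.m<n⇒m%n≡m c<q))
          (trans (sym (ℕ/.[m+kn]%n≡m%n c i q)) (trans (cong (ℕ/._% q) (sym (ℕₚ.*-identityʳ (c + i * q)))) e)))))
        (ℤₚ.*-zeroʳ (sgn (c + i * q) ℤ.* bin (m * q) (c + i * q)))

    Divisible : ℕ → ℕ → ℕ → Set
    Divisible n r m = ∀ j → j < m → Loc (P ℤ.* V q n r m) (T q n r m j)

    V∣T-top : ∀ n r m → V q n r m ∣ℤ T q n r m m
    V∣T-top n r m = divides (sgn (m * q)) (T-top q n r m)

    -- Downward induction. The top value is known only to be a multiple of `W`, so each step asks no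
    -- more than that of its successor.
    descend : ∀ (t : ℕ → ℤ) W m → W ∣ℤ t m →
      (∀ j → j < m → Loc W (t (suc j)) → Loc (P ℤ.* W) (t j)) → ∀ j → j < m → Loc (P ℤ.* W) (t j)
    descend t W m top step j j<m = go (m ∸ suc j) j (trans (ℕₚ.+-suc j (m ∸ suc j)) (ℕₚ.m+[n∸m]≡n j<m))
      where
      go : ∀ d j → j + suc d ≡ m → Loc (P ℤ.* W) (t j)
      go zero    j e = step j (subst (j <_) e (ℕₚ.m<m+n j (s≤s z≤n)))
        (∣⇒Loc (subst (λ z → W ∣ℤ t z) (trans (sym e) (ℕₚ.+-comm j 1)) top))
      go (suc d) j e = step j (subst (j <_) e (ℕₚ.m<m+n j (s≤s z≤n)))
        (Loc-mono {x = t (suc j)} (divides P refl) (go d (suc j) (trans (sym (ℕₚ.+-suc j (suc d))) e)))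

    -- Since R = t + z Q and Q / t lies in p ℤ₍ₚ₎, every R + k Q is `t` times a unit. Absorption at
    -- i = m thus puts N V′ into t V ℤ₍ₚ₎, so N T′_j and Q T_{j+1} both lie in p t V ℤ₍ₚ₎; solving
    -- `T-rec` for T_j and cancelling `t` gives the claim.
    Divisible-step : ∀ n r n′ r′ m R Q N →
      (∀ i → (R ℤ.+ + i ℤ.* Q) ℤ.* bin n (r + i * q) ≡ N ℤ.* bin n′ (r′ + i * q)) →
      ∀ t z u c → .{{_ : ℤ.NonZero t}} → R ≡ t ℤ.+ z ℤ.* Q → ¬ P ∣ℤ u → Q ℤ.* u ≡ P ℤ.* c ℤ.* t →
      Divisible n′ r′ m → Divisible n r m
    Divisible-step n r n′ r′ m R Q N absorb t z u c R≡ P∤u Qu≡ claim =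
      descend (T q n r m) W m (V∣T-top n r m) step
      where
      W = V q n r m
      W′ = V q n′ r′ m
      unit : ℤ → ℤ
      unit k = u ℤ.+ P ℤ.* (c ℤ.* (z ℤ.+ k))
      u[R+kQ] : ∀ k → u ℤ.* (R ℤ.+ k ℤ.* Q) ≡ t ℤ.* unit k
      u[R+kQ] k = begin
        u ℤ.* (R ℤ.+ k ℤ.* Q)                           ≡⟨ cong (λ R → u ℤ.* (R ℤ.+ k ℤ.* Q)) R≡ ⟩
        u ℤ.* (t ℤ.+ z ℤ.* Q ℤ.+ k ℤ.* Q)               ≡⟨ expose u t z Q k ⟩
        u ℤ.* t ℤ.+ Q ℤ.* u ℤ.* (z ℤ.+ k)               ≡⟨ cong (λ x → u ℤ.* t ℤ.+ x ℤ.* (z ℤ.+ k)) Qu≡ ⟩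
        u ℤ.* t ℤ.+ P ℤ.* c ℤ.* t ℤ.* (z ℤ.+ k)         ≡⟨ factor u t P c (z ℤ.+ k) ⟩
        t ℤ.* unit k                                    ∎
        where
        expose : ∀ u t z Q k → u ℤ.* (t ℤ.+ z ℤ.* Q ℤ.+ k ℤ.* Q) ≡ u ℤ.* t ℤ.+ Q ℤ.* u ℤ.* (z ℤ.+ k)
        expose = solve-∀
        factor : ∀ u t P c y → u ℤ.* t ℤ.+ P ℤ.* c ℤ.* t ℤ.* y ≡ t ℤ.* (u ℤ.+ P ℤ.* (c ℤ.* y))
        factor = solve-∀
      NW′ : N ℤ.* W′ ≡ (R ℤ.+ + m ℤ.* Q) ℤ.* W
      NW′ = trans (commute N (+ (m !)) (bin n′ (r′ + m * q)))
        (trans (*-congˡ (+ (m !)) (sym (absorb m))) (commute (+ (m !)) (R ℤ.+ + m ℤ.* Q) (bin n (r + m * q))))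
        where
        commute : ∀ N f b → N ℤ.* (f ℤ.* b) ≡ f ℤ.* (N ℤ.* b)
        commute = solve-∀
      module _ (j : ℕ) (j<m : j < m) (next : Loc W (T q n r m (suc j))) where
        w = T q n r m j
        w⁺ = T q n r m (suc j)
        w′ = T q n′ r′ m j
        uNPW′ : u ℤ.* N ℤ.* (P ℤ.* W′) ≡ unit (+ m) ℤ.* (t ℤ.* (P ℤ.* W))
        uNPW′ = begin
          u ℤ.* N ℤ.* (P ℤ.* W′)                       ≡⟨ front u N P W′ ⟩
          u ℤ.* P ℤ.* (N ℤ.* W′)                       ≡⟨ *-congˡ (u ℤ.* P) NW′ ⟩
          u ℤ.* P ℤ.* ((R ℤ.+ + m ℤ.* Q) ℤ.* W)        ≡⟨ front u P (R ℤ.+ + m ℤ.* Q) W ⟩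
          u ℤ.* (R ℤ.+ + m ℤ.* Q) ℤ.* (P ℤ.* W)        ≡⟨ cong (λ x → x ℤ.* (P ℤ.* W)) (u[R+kQ] (+ m)) ⟩
          t ℤ.* unit (+ m) ℤ.* (P ℤ.* W)               ≡⟨ swap t (unit (+ m)) (P ℤ.* W) ⟩
          unit (+ m) ℤ.* (t ℤ.* (P ℤ.* W))             ∎
          where
          front : ∀ u N P W → u ℤ.* N ℤ.* (P ℤ.* W) ≡ u ℤ.* P ℤ.* (N ℤ.* W)
          front = solve-∀
          swap : ∀ t v x → t ℤ.* v ℤ.* x ≡ v ℤ.* (t ℤ.* x)
          swap = solve-∀
        -QuW : ℤ.- (Q ℤ.* u) ℤ.* W ≡ ℤ.- c ℤ.* (t ℤ.* (P ℤ.* W))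
        -QuW = trans (cong (λ x → ℤ.- x ℤ.* W) Qu≡) (regroup P c t W)
          where
          regroup : ∀ P c t W → ℤ.- (P ℤ.* c ℤ.* t) ℤ.* W ≡ ℤ.- c ℤ.* (t ℤ.* (P ℤ.* W))
          regroup = solve-∀
        combine : u ℤ.* N ℤ.* w′ ℤ.+ ℤ.- (Q ℤ.* u) ℤ.* w⁺ ≡ t ℤ.* (unit (+ j) ℤ.* w)
        combine = begin
          u ℤ.* N ℤ.* w′ ℤ.+ ℤ.- (Q ℤ.* u) ℤ.* w⁺
            ≡⟨ cong (λ x → x ℤ.+ ℤ.- (Q ℤ.* u) ℤ.* w⁺) (ℤₚ.*-assoc u N w′) ⟩
          u ℤ.* (N ℤ.* w′) ℤ.+ ℤ.- (Q ℤ.* u) ℤ.* w⁺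
            ≡⟨ cong (λ x → u ℤ.* x ℤ.+ ℤ.- (Q ℤ.* u) ℤ.* w⁺) (T-rec q n r n′ r′ R Q N absorb m j) ⟨
          u ℤ.* ((R ℤ.+ + j ℤ.* Q) ℤ.* w ℤ.+ Q ℤ.* w⁺) ℤ.+ ℤ.- (Q ℤ.* u) ℤ.* w⁺
            ≡⟨ cancel u (R ℤ.+ + j ℤ.* Q) w Q w⁺ ⟩
          u ℤ.* (R ℤ.+ + j ℤ.* Q) ℤ.* w
            ≡⟨ cong (λ x → x ℤ.* w) (u[R+kQ] (+ j)) ⟩
          t ℤ.* unit (+ j) ℤ.* w
            ≡⟨ ℤₚ.*-assoc t (unit (+ j)) w ⟩
          t ℤ.* (unit (+ j) ℤ.* w) ∎
          where
          cancel : ∀ u A w Q w⁺ → u ℤ.* (A ℤ.* w ℤ.+ Q ℤ.* w⁺) ℤ.+ ℤ.- (Q ℤ.* u) ℤ.* w⁺ ≡ u ℤ.* A ℤ.* w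
          cancel = solve-∀
        step : Loc (P ℤ.* W) w
        step = Loc-cancel-unit {x = w} (unit (+ j)) (P∤+multiple (c ℤ.* (z ℤ.+ + j)) P∤u) $
          Loc-cancel {x = unit (+ j) ℤ.* w} t $ subst (Loc (t ℤ.* (P ℤ.* W))) combine $
          Loc-+ {x = u ℤ.* N ℤ.* w′} {y = ℤ.- (Q ℤ.* u) ℤ.* w⁺}
            (Loc-mono {x = u ℤ.* N ℤ.* w′} (divides (unit (+ m)) uNPW′) (Loc-scale {x = w′} (u ℤ.* N) (claim j j<m)))
            (Loc-mono {x = ℤ.- (Q ℤ.* u) ℤ.* w⁺} (divides (ℤ.- c) -QuW) (Loc-scale {x = w⁺} (ℤ.- (Q ℤ.* u)) next))

    Divisible-suc-r : ∀ n r m → suc r < q → Divisible n r m → Divisible (suc n) (suc r) m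
    Divisible-suc-r n r m r<q =
      let u , c , P∤u , qu≡ = p-part α (suc r) (s≤s z≤n) r<q in
      Divisible-step (suc n) (suc r) n r m (+ suc r) (+ q) (+ suc n)
        (λ i → trans (cong (λ z → z ℤ.* bin (suc n) (suc r + i * q)) (sym (pos-+-* (suc r) i q))) (bin-absorb n (r + i * q)))
        (+ suc r) 0ℤ u c (sym (ℤₚ.+-identityʳ (+ suc r))) P∤u qu≡

    Divisible-suc-s : ∀ n r s m → suc n ≡ r + suc s + m * q → suc s < q → Divisible n r m → Divisible (suc n) r m
    Divisible-suc-s n r s m n≡ s<q =
      let u , c , P∤u , qu≡ = p-part α (suc s) (s≤s z≤n) s<q in
      Divisible-step (suc n) r n r m (+ suc n ℤ.- + r) (ℤ.- + q) (+ suc n)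
        (λ i → trans (cong (λ z → z ℤ.* bin (suc n) (r + i * q))
          (trans (regroup (+ suc n) (+ r) (+ i) (+ q)) (cong (λ z → + suc n ℤ.- z) (sym (pos-+-* r i q))))) (bin-absorb′ n (r + i * q)))
        -- Here `R` is `n + 1 - r = suc s + m q` and `Q` is `- q`, so `R = t + z Q` with `t = suc s`
        -- and `z = - m`; the sign of `Q` is moved into `c`.
        (+ suc s) (ℤ.- + m) u (ℤ.- c)
        (trans (cong (λ z → + z ℤ.- + r) n≡) (trans (cong (λ z → z ℤ.- + r) (trans (pos-+-* (r + suc s) m q) (cong (λ z → z ℤ.+ + m ℤ.* + q) (ℤₚ.pos-+ r (suc s)))))
          (solve-R (+ r) (+ suc s) (+ m) (+ q))))
        P∤u (trans (sym (ℤₚ.neg-distribˡ-* (+ q) u)) (trans (cong ℤ.-_ qu≡) (negate P c (+ suc s))))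
      where
      regroup : ∀ N r i q → N ℤ.- r ℤ.+ i ℤ.* (ℤ.- q) ≡ N ℤ.- (r ℤ.+ i ℤ.* q)
      regroup = solve-∀
      solve-R : ∀ r s m q → r ℤ.+ s ℤ.+ m ℤ.* q ℤ.- r ≡ s ℤ.+ (ℤ.- m) ℤ.* (ℤ.- q)
      solve-R = solve-∀
      negate : ∀ P c s → ℤ.- (P ℤ.* c ℤ.* s) ≡ P ℤ.* (ℤ.- c) ℤ.* s
      negate = solve-∀

    -- Both binomials in `V` are 1. For j = 0, p^(m+1) divides T_0 and (m+1)! has smaller valuation;
    -- for larger j, the factor m + 1 of `T-00` turns m! into (m+1)!.
    Divisible-00 : ∀ m → Divisible (ℕ.pred q + m * q) (ℕ.pred q) m → Divisible (suc m * q) 0 (suc m)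
    Divisible-00 m claim zero    _ = Loc-trans {x = T q (suc m * q) 0 (suc m) 0}
      (subst (λ z → Loc (P ℤ.* z) (P ℤ.^ suc m)) (sym V≡) (Loc-P!-P^ (suc (suc m)) (suc m) (ℕₚ.n<1+n (suc m)) (s≤s z≤n)))
      (∣⇒Loc (P^∣T-00 (suc m)))
      where
      V≡ : V q (suc m * q) 0 (suc m) ≡ + (suc m !)
      V≡ = trans (*-congˡ (+ (suc m !)) (bin-n-n (suc m * q))) (ℤₚ.*-identityʳ (+ (suc m !)))
    Divisible-00 m claim (suc j) (s≤s j<m) = subst (Loc (P ℤ.* V q (suc m * q) 0 (suc m))) (sym (T-00 q m j)) $
      Loc-mono {x = c ℤ.* w′} (divides (sgn q) cPV′) (Loc-scale {x = w′} c (claim j j<m))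
      where
      c = sgn q ℤ.* + suc m
      n = ℕ.pred q + m * q
      w′ = T q n (ℕ.pred q) m j
      regroup : ∀ s m P f → s ℤ.* m ℤ.* (P ℤ.* (f ℤ.* 1ℤ)) ≡ s ℤ.* (P ℤ.* (m ℤ.* f ℤ.* 1ℤ))
      regroup = solve-∀
      cPV′ : c ℤ.* (P ℤ.* V q n (ℕ.pred q) m) ≡ sgn q ℤ.* (P ℤ.* V q (suc m * q) 0 (suc m))
      cPV′ = begin
        c ℤ.* (P ℤ.* (+ (m !) ℤ.* bin n n))
          ≡⟨ cong (λ b → c ℤ.* (P ℤ.* (+ (m !) ℤ.* b))) (bin-n-n n) ⟩
        c ℤ.* (P ℤ.* (+ (m !) ℤ.* 1ℤ))
          ≡⟨ regroup (sgn q) (+ suc m) P (+ (m !)) ⟩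
        sgn q ℤ.* (P ℤ.* (+ suc m ℤ.* + (m !) ℤ.* 1ℤ))
          ≡⟨ cong₂ (λ f b → sgn q ℤ.* (P ℤ.* (f ℤ.* b))) (ℤₚ.pos-* (suc m) (m !)) (bin-n-n (suc m * q)) ⟨
        sgn q ℤ.* (P ℤ.* V q (suc m * q) 0 (suc m)) ∎

    -- First `s` is lowered to 0, then `r`; after that `m` drops by one and `r` restarts at q - 1.
    T-Divisible : ∀ m r s → r < q → s < q → Divisible (r + s + m * q) r m
    T-Divisible zero    r s r<q s<q j ()
    T-Divisible (suc m) r (suc s) r<q s<q = subst (λ n → Divisible n r (suc m)) n≡
      (Divisible-suc-s (r + s + suc m * q) r s (suc m) n≡ s<q (T-Divisible (suc m) r s r<q (ℕₚ.<-trans (ℕₚ.n<1+n s) s<q)))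
      where
      n≡ : suc (r + s + suc m * q) ≡ r + suc s + suc m * q
      n≡ = cong (λ z → z + suc m * q) (sym (ℕₚ.+-suc r s))
    T-Divisible (suc m) (suc r) zero r<q s<q =
      Divisible-suc-r (r + 0 + suc m * q) r (suc m) r<q (T-Divisible (suc m) r zero (ℕₚ.<-trans (ℕₚ.n<1+n r) r<q) s<q)
    T-Divisible (suc m) zero zero r<q s<q = Divisible-00 m
      (subst (λ n → Divisible n (ℕ.pred q) m) (cong (λ z → z + m * q) (ℕₚ.+-identityʳ (ℕ.pred q)))
        (T-Divisible m (ℕ.pred q) 0 (ℕₚ.≤-reflexive (ℕₚ.suc-pred q)) (ℕₚ.m^n>0 p α)))

    -- Comparison of V with the denominator

    +multiple∼ : ∀ t k → 0 < t → t < q → + (t + k * q) ∼ + t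
    +multiple∼ t k 0<t t<q =
      let u , c , P∤u , qu≡ = p-part α t 0<t t<q in
      -- The ratio of the two sides is 1 + k (q / t), where q / t = p c / u.
      u , u ℤ.+ P ℤ.* (c ℤ.* + k) , P∤u ,
      mod (divides (ℤ.- (c ℤ.* + k)) (minus u P (c ℤ.* + k))) , (begin
        u ℤ.* + (t + k * q)                    ≡⟨ *-congˡ u (pos-+-* t k q) ⟩
        u ℤ.* (+ t ℤ.+ + k ℤ.* + q)            ≡⟨ expose u (+ t) (+ k) (+ q) ⟩
        u ℤ.* + t ℤ.+ + k ℤ.* (+ q ℤ.* u)      ≡⟨ cong (λ z → u ℤ.* + t ℤ.+ + k ℤ.* z) qu≡ ⟩
        u ℤ.* + t ℤ.+ + k ℤ.* (P ℤ.* c ℤ.* + t) ≡⟨ factor u (+ t) (+ k) P c ⟩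
        (u ℤ.+ P ℤ.* (c ℤ.* + k)) ℤ.* + t       ∎)
      where
      minus : ∀ u P x → u ℤ.- (u ℤ.+ P ℤ.* x) ≡ ℤ.- x ℤ.* P
      minus = solve-∀
      expose : ∀ u t k q → u ℤ.* (t ℤ.+ k ℤ.* q) ≡ u ℤ.* t ℤ.+ k ℤ.* (q ℤ.* u)
      expose = solve-∀
      factor : ∀ u t k P c → u ℤ.* t ℤ.+ k ℤ.* (P ℤ.* c ℤ.* t) ≡ (u ℤ.+ P ℤ.* (c ℤ.* k)) ℤ.* t
      factor = solve-∀

    -- Unless `suc x` is `q`, the floor does not change, and `suc x + m q` and `suc x` share a
    -- nonzero residue modulo `q`, hence agree up to 1 + p ℤ₍ₚ₎. At `suc x = q` the floor rises from
    -- `m` to `m + 1`, and both sides equal (m+1)! q.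
    floor-!-step : ∀ m x → suc x < q + q →
      + (suc x + m * q) ℤ.* + (((x + m * q) ndiv⁺ q) !) ∼ + (((suc x + m * q) ndiv⁺ q) !) ℤ.* + suc x
    floor-!-step m x x<2q with ℕₚ.<-cmp (suc x) q
    ... | tri< 1+x<q _ _ = subst₂ (λ i j → + (suc x + m * q) ℤ.* + (i !) ∼ + (j !) ℤ.* + suc x)
      (sym (ndiv⁺-unique x m q (ℕₚ.<-trans (ℕₚ.n<1+n x) 1+x<q))) (sym (ndiv⁺-unique (suc x) m q 1+x<q))
      (∼-trans (∼-* (+multiple∼ (suc x) m (s≤s z≤n) 1+x<q) (∼-reflexive {+ (m !)} refl))
               (∼-reflexive (ℤₚ.*-comm (+ suc x) (+ (m !)))))
    ... | tri≈ _ 1+x≡q _ = subst₂ (λ i j → + (suc x + m * q) ℤ.* + (i !) ∼ + (j !) ℤ.* + suc x)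
      (sym (ndiv⁺-unique x m q (ℕₚ.≤-reflexive 1+x≡q)))
      (sym (trans (cong (λ z → (z + m * q) ndiv⁺ q) 1+x≡q) (ndiv⁺-unique 0 (suc m) q (ℕₚ.m^n>0 p α))))
      (∼-reflexive (begin
        + (suc x + m * q) ℤ.* + (m !)      ≡⟨ cong (λ z → + (z + m * q) ℤ.* + (m !)) 1+x≡q ⟩
        + (suc m * q) ℤ.* + (m !)          ≡⟨ cong (λ z → z ℤ.* + (m !)) (ℤₚ.pos-* (suc m) q) ⟩
        + suc m ℤ.* + q ℤ.* + (m !)        ≡⟨ regroup (+ suc m) (+ q) (+ (m !)) ⟩
        + suc m ℤ.* + (m !) ℤ.* + q        ≡⟨ cong (λ z → z ℤ.* + q) (ℤₚ.pos-* (suc m) (m !)) ⟨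
        + (suc m !) ℤ.* + q                ≡⟨ cong (λ z → + (suc m !) ℤ.* + z) 1+x≡q ⟨
        + (suc m !) ℤ.* + suc x            ∎))
      where
      regroup : ∀ m q f → m ℤ.* q ℤ.* f ≡ m ℤ.* f ℤ.* q
      regroup = solve-∀
    ... | tri> _ _ (s≤s q≤x) = subst₂ (λ i j → + (suc x + m * q) ℤ.* + (i !) ∼ + (j !) ℤ.* + suc x)
      (sym (trans (cong (_ndiv⁺ q) x+mq) (ndiv⁺-unique y (suc m) q (ℕₚ.<-trans (ℕₚ.n<1+n y) 1+y<q))))
      (sym (trans (cong (λ z → suc z ndiv⁺ q) x+mq) (ndiv⁺-unique (suc y) (suc m) q 1+y<q)))
      (∼-trans (∼-* (∼-trans (∼-trans
          (∼-reflexive (cong (λ z → + suc z) x+mq))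
          (+multiple∼ (suc y) (suc m) (s≤s z≤n) 1+y<q))
          (∼-sym (∼-trans (∼-reflexive (cong +_ 1+x≡)) (+multiple∼ (suc y) 1 (s≤s z≤n) 1+y<q))))
          (∼-reflexive {+ (suc m !)} refl))
        (∼-reflexive (ℤₚ.*-comm (+ suc x) (+ (suc m !)))))
      where
      y = x ∸ q
      y+q : y + q ≡ x
      y+q = ℕₚ.m∸n+n≡m q≤x
      1+x≡ : suc x ≡ suc y + 1 * q
      1+x≡ = cong suc (trans (sym y+q) (cong (λ z → y + z) (sym (ℕₚ.*-identityˡ q))))
      1+y<q : suc y < q
      1+y<q = ℕₚ.+-cancelʳ-< q (suc y) q (subst (λ z → suc z < q + q) (sym y+q) x<2q)
      x+mq : x + m * q ≡ y + suc m * q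
      x+mq = trans (cong (λ z → z + m * q) (sym y+q)) (ℕₚ.+-assoc y q (m * q))

    -- The denominator of the theorem, for n = r + s + m q and n_* = r + s.
    D : ℕ → ℕ → ℕ → ℤ
    D r s m = + (((r + s + m * q) ndiv⁺ q) !) ℤ.* bin (r + s) r

    -- Induction on `s`; for `s = 0` both binomials are 1. Multiplied by `suc s`, each binomial
    -- drops to the previous `s` by `bin-absorb′`, and `floor-!-step` compares the factors that this
    -- produces.
    V∼D : ∀ m r s → r < q → s < q → V q (r + s + m * q) r m ∼ D r s m
    V∼D m r zero r<q s<q = ∼-reflexive (cong₂ ℤ._*_
      (cong (λ i → + (i !)) (sym (trans (cong (λ z → (z + m * q) ndiv⁺ q) (ℕₚ.+-identityʳ r)) (ndiv⁺-unique r m q r<q))))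
      (trans (cong (λ z → bin (z + m * q) (r + m * q)) (ℕₚ.+-identityʳ r))
        (trans (bin-n-n (r + m * q)) (sym (trans (cong (λ z → bin z r) (ℕₚ.+-identityʳ r)) (bin-n-n r))))))
    V∼D m r (suc s) r<q 1+s<q = ∼-cancel (+ suc s)
      (∼-trans (∼-reflexive sV) (∼-trans (∼-* (∼-reflexive {+ suc n} refl) (V∼D m r s r<q s<q))
      (∼-trans (∼-reflexive (sym (ℤₚ.*-assoc (+ suc n) (+ ((n ndiv⁺ q) !)) (bin (r + s) r))))
      (∼-trans (∼-* (floor-!-step m (r + s) (subst (_< q + q) (ℕₚ.+-suc r s) (ℕₚ.+-mono-< r<q 1+s<q))) (∼-reflexive {bin (r + s) r} refl))
      (∼-reflexive (sym sD))))))
      where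
      s<q = ℕₚ.<-trans (ℕₚ.n<1+n s) 1+s<q
      n = r + s + m * q
      n≡ : r + suc s + m * q ≡ suc n
      n≡ = cong (λ z → z + m * q) (ℕₚ.+-suc r s)
      commute : ∀ N f b → N ℤ.* (f ℤ.* b) ≡ f ℤ.* (N ℤ.* b)
      commute = solve-∀
      minus : ∀ r s → r ℤ.+ s ℤ.- r ≡ s
      minus = solve-∀
      shuffle : ∀ r s x → r ℤ.+ s ℤ.+ x ℤ.- (r ℤ.+ x) ≡ s
      shuffle = solve-∀
      n-k : + suc n ℤ.- + (r + m * q) ≡ + suc s
      n-k = begin
        + suc n ℤ.- + (r + m * q)                            ≡⟨ cong (λ z → + z ℤ.- + (r + m * q)) n≡ ⟨
        + (r + suc s + m * q) ℤ.- + (r + m * q)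
          ≡⟨ cong₂ ℤ._-_
               (trans (ℤₚ.pos-+ (r + suc s) (m * q)) (cong (λ z → z ℤ.+ + (m * q)) (ℤₚ.pos-+ r (suc s))))
               (ℤₚ.pos-+ r (m * q)) ⟩
        + r ℤ.+ + suc s ℤ.+ + (m * q) ℤ.- (+ r ℤ.+ + (m * q)) ≡⟨ shuffle (+ r) (+ suc s) (+ (m * q)) ⟩
        + suc s                                              ∎
      sV : + suc s ℤ.* V q (r + suc s + m * q) r m ≡ + suc n ℤ.* V q n r m
      sV = begin
        + suc s ℤ.* (+ (m !) ℤ.* bin (r + suc s + m * q) (r + m * q))
          ≡⟨ commute (+ suc s) (+ (m !)) _ ⟩
        + (m !) ℤ.* (+ suc s ℤ.* bin (r + suc s + m * q) (r + m * q))
          ≡⟨ cong₂ (λ x N → + (m !) ℤ.* (x ℤ.* bin N (r + m * q))) (sym n-k) n≡ ⟩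
        + (m !) ℤ.* ((+ suc n ℤ.- + (r + m * q)) ℤ.* bin (suc n) (r + m * q))
          ≡⟨ *-congˡ (+ (m !)) (bin-absorb′ n (r + m * q)) ⟩
        + (m !) ℤ.* (+ suc n ℤ.* bin n (r + m * q))
          ≡⟨ commute (+ (m !)) (+ suc n) _ ⟩
        + suc n ℤ.* V q n r m ∎
      F′ = + ((suc n ndiv⁺ q) !)
      sb : + suc s ℤ.* bin (r + suc s) r ≡ + suc (r + s) ℤ.* bin (r + s) r
      sb = trans (cong₂ (λ x N → x ℤ.* bin N r)
          (trans (sym (minus (+ r) (+ suc s))) (cong (λ z → z ℤ.- + r) (trans (sym (ℤₚ.pos-+ r (suc s))) (cong +_ (ℕₚ.+-suc r s)))))
          (ℕₚ.+-suc r s))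
        (bin-absorb′ (r + s) r)
      sD : + suc s ℤ.* D r (suc s) m ≡ F′ ℤ.* + suc (r + s) ℤ.* bin (r + s) r
      sD = begin
        + suc s ℤ.* (+ (((r + suc s + m * q) ndiv⁺ q) !) ℤ.* bin (r + suc s) r)
          ≡⟨ cong (λ N → + suc s ℤ.* (+ ((N ndiv⁺ q) !) ℤ.* bin (r + suc s) r)) n≡ ⟩
        + suc s ℤ.* (F′ ℤ.* bin (r + suc s) r)
          ≡⟨ commute (+ suc s) F′ _ ⟩
        F′ ℤ.* (+ suc s ℤ.* bin (r + suc s) r)
          ≡⟨ *-congˡ F′ sb ⟩
        F′ ℤ.* (+ suc (r + s) ℤ.* bin (r + s) r)
          ≡⟨ ℤₚ.*-assoc F′ (+ suc (r + s)) (bin (r + s) r) ⟨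
        F′ ℤ.* + suc (r + s) ℤ.* bin (r + s) r ∎

    -- The congruence for the sum over a residue class

    section-sum : ℕ → ℕ → ℕ → ℕ → ℤ → ℤ
    section-sum r s m l a =
      ∑ (suc m) (λ i → sgn (r + i * q) ℤ.* bin (r + s + m * q) (r + i * q) ℤ.* (+ i ℤ.- a) ℤ.^ l)

    section-sum-congruence : ∀ m r s l a → r < q → s < q → m ≤ l →
      newton (λ k → + k ℤ.- a) l m ≈ 1ℤ → sgn (m * q) ≈ sgn l →
      Loc (P ℤ.* D r s m) (section-sum r s m l a ℤ.- sgn (l + r) ℤ.* D r s m)
    section-sum-congruence m r s l a r<q s<q m≤l h≈ sgn≈ =
      -- Three errors are added: the terms j ≠ m, the replacement of h(l,m) T_m by (-1)^l V, and
      -- that of `V` by the denominator. The factor (-1)^r is restored at the end.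
      subst (Loc (P ℤ.* W′)) final (Loc-* {x = X ℤ.- sgn l ℤ.* W′} (sgn r)
      (subst (Loc (P ℤ.* W′)) (telescope X (h m ℤ.* t m) (sgn l) W W′)
        (Loc-+ {x = (X ℤ.- h m ℤ.* t m) ℤ.+ (h m ℤ.* t m ℤ.- sgn l ℤ.* W)} {y = sgn l ℤ.* (W ℤ.- W′)}
          (Loc-trans {x = (X ℤ.- h m ℤ.* t m) ℤ.+ (h m ℤ.* t m ℤ.- sgn l ℤ.* W)} (∼⇒Loc V∼)
            (Loc-+ {x = X ℤ.- h m ℤ.* t m} {y = h m ℤ.* t m ℤ.- sgn l ℤ.* W} lower top))
          (Loc-* {x = W ℤ.- W′} (sgn l) (∼⇒Loc-- V∼)))))
      where
      n = r + s + m * q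
      W = V q n r m
      W′ = D r s m
      V∼ : W ∼ W′
      V∼ = V∼D m r s r<q s<q
      h t : ℕ → ℤ
      h = newton (λ k → + k ℤ.- a) l
      t = T q n r m
      X = ∑ (suc l) (λ j → h j ℤ.* t j)
      lower : Loc (P ℤ.* W) (X ℤ.- h m ℤ.* t m)
      lower = ∑-closed-except (Loc (P ℤ.* W)) Loc-0 (λ {x} {y} → Loc-+ {x = x} {y = y})
        (suc l) m (λ j → h j ℤ.* t j) (s≤s m≤l) others
        where
        others : ∀ j → j < suc l → j ≢ m → Loc (P ℤ.* W) (h j ℤ.* t j)
        others j _ j≢m with ℕₚ.<-cmp j m
        ... | tri< j<m _ _ = Loc-* {x = t j} (h j) (T-Divisible m r s r<q s<q j j<m)
        ... | tri≈ _ j≡m _ = contradiction j≡m j≢m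
        ... | tri> _ _ m<j = subst (Loc (P ℤ.* W)) (sym (trans (*-congˡ (h j) (T>≡0 q n r m j m<j)) (ℤₚ.*-zeroʳ (h j)))) Loc-0
      top : Loc (P ℤ.* W) (h m ℤ.* t m ℤ.- sgn l ℤ.* W)
      top = let divides k hs-s≡ = unmod (≈-trans (≈-* h≈ sgn≈) (≈-reflexive (ℤₚ.*-identityˡ (sgn l)))) in
        ∣⇒Loc (divides k (begin
          h m ℤ.* t m ℤ.- sgn l ℤ.* W                       ≡⟨ cong (λ z → h m ℤ.* z ℤ.- sgn l ℤ.* W) (T-top q n r m) ⟩
          h m ℤ.* (sgn (m * q) ℤ.* W) ℤ.- sgn l ℤ.* W       ≡⟨ factor (h m) (sgn (m * q)) (sgn l) W ⟩
          (h m ℤ.* sgn (m * q) ℤ.- sgn l) ℤ.* W             ≡⟨ cong (λ z → z ℤ.* W) hs-s≡ ⟩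
          k ℤ.* P ℤ.* W                                     ≡⟨ ℤₚ.*-assoc k P W ⟩
          k ℤ.* (P ℤ.* W)                                   ∎))
        where
        factor : ∀ h s s′ w → h ℤ.* (s ℤ.* w) ℤ.- s′ ℤ.* w ≡ (h ℤ.* s ℤ.- s′) ℤ.* w
        factor = solve-∀
      telescope : ∀ x y s w w′ → ((x ℤ.- y) ℤ.+ (y ℤ.- s ℤ.* w)) ℤ.+ s ℤ.* (w ℤ.- w′) ≡ x ℤ.- s ℤ.* w′
      telescope = solve-∀
      distrib : ∀ s x s′ w → s ℤ.* (x ℤ.- s′ ℤ.* w) ≡ s ℤ.* x ℤ.- s′ ℤ.* s ℤ.* w
      distrib = solve-∀
      final : sgn r ℤ.* (X ℤ.- sgn l ℤ.* W′) ≡ section-sum r s m l a ℤ.- sgn (l + r) ℤ.* W′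
      final = trans (distrib (sgn r) X (sgn l) W′)
        (cong₂ (λ x y → x ℤ.- y ℤ.* W′) (sym (∑-newton-T q n r m l a)) (sym (ℤₚ.^-distribˡ-+-* -1ℤ l r)))

    -- Modulo `p` both sides are (-1)^m, because (-1)^p ≡ -1 and (-1)^(p-1) ≡ 1, also when `p` is 2.
    sgn-mq : ∀ m t x → sgn (m * q) ≈ sgn (m + t * ((p ∸ 1) * x))
    sgn-mq m t x = ≈-trans (≈-reflexive (cong sgn (ℕₚ.*-comm m q))) (≈-trans (sgn-p^* α m)
      (≈-trans (≈-sym (≈-trans (≈-* (≈-refl {sgn m}) (sgn-[p-1]* (x * t))) (≈-reflexive (ℤₚ.*-identityʳ (sgn m)))))
      (≈-reflexive (trans (sym (ℤₚ.^-distribˡ-+-* -1ℤ m ((p ∸ 1) * (x * t))))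
        (cong (λ z → sgn (m + z)) (trans (sym (ℕₚ.*-assoc (p ∸ 1) x t)) (ℕₚ.*-comm ((p ∸ 1) * x) t)))))))

    newton≈1 : ∀ a m e t → p ^ e ≤ m → m < p ^ suc e →
      newton (λ k → + k ℤ.- a) (m + t * ((p ∸ 1) * p ^ (e ∸ δ p a m e))) m ≈ 1ℤ
    newton≈1 a m e t q≤m m<pq with δ p a m e | δ-cases p a m e
    -- `δ` is abstracted together with its case analysis, so that `e ∸ δ p a m e` reduces. In the
    -- second case `1 ≤ e` forces `e` to be a successor, and the exponent becomes its predecessor.
    ... | .0 | inj₁ refl = Periodicity.h≈1-generic a e m t q≤m m<pq
    newton≈1 a m (suc e) t q≤m m<pq | .1 | inj₂ (refl , p∣a , _ , q≡m) =
      Periodicity.h≈1-δ a e m t q≡m (ℤ∣.∣ᵤ⇒∣ p∣a)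

    -- Translation to the original sum and quotient

    module _ (r : ℤ) where
      r* a : _
      r* = r mod⁺ q
      a = r div⁺ q

      n-decomposition : ∀ n m → a ℤ.+ (+ n ℤ.- r) div⁺ q ≡ + m →
        n ≡ r* + (+ n ℤ.- r) mod⁺ q + m * q
      n-decomposition n m m≡ = ℤₚ.+-injective (begin
        + n                                                        ≡⟨ split (+ n) r ⟩
        r ℤ.+ (+ n ℤ.- r)                                          ≡⟨ cong₂ ℤ._+_ (mod⁺-div⁺ r q) (mod⁺-div⁺ (+ n ℤ.- r) q) ⟩
        (+ r* ℤ.+ a ℤ.* + q) ℤ.+ (+ s* ℤ.+ b ℤ.* + q)              ≡⟨ regroup (+ r*) a (+ q) (+ s*) b ⟩
        (+ r* ℤ.+ + s*) ℤ.+ (a ℤ.+ b) ℤ.* + q                      ≡⟨ cong₂ (λ x y → x ℤ.+ y ℤ.* + q) (sym (ℤₚ.pos-+ r* s*)) m≡ ⟩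
        + (r* + s*) ℤ.+ + m ℤ.* + q                                ≡⟨ pos-+-* (r* + s*) m q ⟨
        + (r* + s* + m * q)                                        ∎)
        where
        s* = (+ n ℤ.- r) mod⁺ q
        b = (+ n ℤ.- r) div⁺ q
        split : ∀ n r → n ≡ r ℤ.+ (n ℤ.- r)
        split = solve-∀
        regroup : ∀ r a q s b → (r ℤ.+ a ℤ.* q) ℤ.+ (s ℤ.+ b ℤ.* q) ≡ (r ℤ.+ s) ℤ.+ (a ℤ.+ b) ℤ.* q
        regroup = solve-∀

      summand : ℕ → ℕ → ℕ → ℤ
      summand n l k = sgn k ℤ.* + (n C k) ℤ.* ((+ k ℤ.- r) div⁺ q) ℤ.^ l

      term-off : ∀ n l k → (+ k) mod⁺ q ≢ r* → term p α n r l k ≡ 0ℤ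
      term-off n l k k≢r = cong (λ c → if c then summand n l k else + 0) (dec-false ((+ k) mod⁺ q ℕ.≟ r*) k≢r)

      term-on : ∀ n l i → term p α n r l (r* + i * q) ≡ sgn (r* + i * q) ℤ.* bin n (r* + i * q) ℤ.* (+ i ℤ.- a) ℤ.^ l
      term-on n l i = trans
        (cong (λ c → if c then summand n l (r* + i * q) else + 0)
          (dec-true ((+ (r* + i * q)) mod⁺ q ℕ.≟ r*) (mod⁺-unique r* i q (mod⁺< r q))))
        (cong₂ (λ x y → sgn (r* + i * q) ℤ.* x ℤ.* y ℤ.^ l) (sym (bin≡C n (r* + i * q)))
          (trans (cong (_div⁺ q) k-r) (div⁺-multiple (+ i ℤ.- a) q)))
        where
        cancel : ∀ ρ i a q → (ρ ℤ.+ i ℤ.* q) ℤ.- (ρ ℤ.+ a ℤ.* q) ≡ (i ℤ.- a) ℤ.* q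
        cancel = solve-∀
        k-r : + (r* + i * q) ℤ.- r ≡ (+ i ℤ.- a) ℤ.* + q
        k-r = trans (cong₂ ℤ._-_ (pos-+-* r* i q) (mod⁺-div⁺ r q)) (cancel (+ r*) (+ i) a (+ q))

      binSum≡ : ∀ s m l → s < q → binSum p α (r* + s + m * q) r l ≡ section-sum r* s m l a
      binSum≡ s m l s<q = trans (foldr-upTo (suc n) (term p α n r l))
        (trans (∑-residue q r* s m (term p α n r l) (mod⁺< r q) s<q
          (λ c i c<q c≢r → term-off n l (c + i * q) λ e → c≢r (trans (sym (mod⁺-unique c i q c<q)) e)))
        (∑-cong (suc m) (term-on n l)))
        where
        n = r* + s + m * q

      binSum-congruence : ∀ s m l → s < q → m ≤ l → newton (λ k → + k ℤ.- a) l m ≈ 1ℤ → sgn (m * q) ≈ sgn l →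
        let n = r* + s + m * q in
        (binSum p α n r l ÷⁺ ((n ndiv⁺ q) ! * ((r* + s) C r*))) ≡ (sgn (l + r*) ℚ./ 1) [modpℤₚ p ]
      binSum-congruence s m l s<q m≤l h≈ sgn≈ = finish (section-sum-congruence m r* s l a (mod⁺< r q) s<q m≤l h≈ sgn≈)
        where
        n = r* + s + m * q
        d = (n ndiv⁺ q) ! * ((r* + s) C r*)
        d>0 : 0 < d
        d>0 = ℕₚ.*-mono-≤ (ℕₚ.1≤n! (n ndiv⁺ q)) (C>0 r* s)
        +d : + d ≡ D r* s m
        +d = trans (ℤₚ.pos-* ((n ndiv⁺ q) !) ((r* + s) C r*)) (*-congˡ (+ ((n ndiv⁺ q) !)) (sym (bin≡C (r* + s) r*)))
        rotate : ∀ k P x → k ℤ.* (P ℤ.* x) ≡ P ℤ.* k ℤ.* x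
        rotate = solve-∀
        finish : Loc (P ℤ.* D r* s m) (section-sum r* s m l a ℤ.- sgn (l + r*) ℤ.* D r* s m) →
          (binSum p α n r l ÷⁺ d) ≡ (sgn (l + r*) ℚ./ 1) [modpℤₚ p ]
        -- The multiplier `u` that clears the denominators prime to `p` serves as the integer `b` in
        -- the definition of the rational congruence.
        finish (u , P∤u , divides k eq) = k , u , P∤u ∘ ℤ∣.∣ᵤ⇒∣ ,
          ÷⁺-cross-multiply (binSum p α n r l) (sgn (l + r*)) u (P ℤ.* k) d d>0 (begin
          u ℤ.* (binSum p α n r l ℤ.- sgn (l + r*) ℤ.* + d)
            ≡⟨ cong₂ (λ x y → u ℤ.* (x ℤ.- sgn (l + r*) ℤ.* y)) (binSum≡ s m l s<q) +d ⟩
          u ℤ.* (section-sum r* s m l a ℤ.- sgn (l + r*) ℤ.* D r* s m)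
            ≡⟨ eq ⟩
          k ℤ.* (P ℤ.* D r* s m)
            ≡⟨ rotate k P (D r* s m) ⟩
          P ℤ.* k ℤ.* D r* s m
            ≡⟨ *-congˡ (P ℤ.* k) (sym +d) ⟩
          P ℤ.* k ℤ.* + d ∎)

theorem1p2 : (p : ℕ) → Prime p → (α l n : ℕ) (r : ℤ) (m : ℕ) →
    mVal p α n r ≡ + m → 0 < m → m ≤ l →
    (e : ℕ) → p ^ e ≤ m → m < p ^ suc e →
    ((p ∸ 1) * p ^ (e ∸ δ p (r div⁺ (p ^ α)) m e)) ∣ (l ∸ m) →
    lhs p α n r l ≡ ((ℤ.-1ℤ ℤ.^ (l + rStar p α r)) ℚ./ 1) [modpℤₚ p ]
theorem1p2 p p-prime α l n r m m≡ 0<m m≤l e q≤m m<pq (ℕ∣.divides t l∸m≡) =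
  -- Only the `n` of the sum and of the factorial is rewritten as r_* + s + m q; n_* is already r_*
  -- + s by definition, with `s` the residue of the given `n - r`.
  subst (λ N → (binSum p α N r l ÷⁺ ((N ndiv⁺ q) ! * ((r* r + s) C r* r))) ≡ (sgn (l + r* r) ℚ./ 1) [modpℤₚ p ])
    (sym (n-decomposition r n m m≡))
    (binSum-congruence r s m l (mod⁺< (+ n ℤ.- r) q) m≤l
      (subst (λ l → newton (λ k → + k ℤ.- a r) l m ≈ 1ℤ) (sym l≡) (newton≈1 (a r) m e t q≤m m<pq))
      (subst (λ l → sgn (m * q) ≈ sgn l) (sym l≡) (sgn-mq m t _)))
  where
  open ModPrime p p-prime
  open Sections α
  s = (+ n ℤ.- r) mod⁺ q
  l≡ : l ≡ m + t * ((p ∸ 1) * p ^ (e ∸ δ p (a r) m e))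
  l≡ = trans (sym (ℕₚ.m+[n∸m]≡n m≤l)) (cong (λ z → m + z) l∸m≡)
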